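{- Given a directed acyclic graph $G$ with $n$ vertices and $m$ arcs, and a vertex $s \in G$, one can construct in time $O(m)$ a data structure for disjoint sets that allows one to answer in constant time, for any pair of vertices $u, v \in G$, whether $s$ is or is not a junction of $u, v$. Moreover, after this construction, all pairs of vertices that have $s$ as a junction can be printed out in $O(k)$ time, where $k$ is the number of such pairs.
   Context: All paths are directed, and a single vertex counts as a (trivial) directed path. For distinct vertices $u,v$ of a directed acyclic graph $G$, a vertex $s\in G$ is a junction of $u,v$ if there are internally disjoint directed paths $P$ from $s$ to $u$ and $Q$ from $s$ to $v$ in $G$, where internally disjoint means that $s$ is the only vertex common to $P$ and $Q$. In particular, if $u$ is a proper ancestor of $v$, then $u$ is a junction of $u,v$. By convention no vertex is a junction of a pair $u,u$. A data structure for disjoint sets stores a partition of a set of vertices, each block being identified by one of its elements (its representative). -}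

module Defs where

open import Data.Bool using (Bool; true; false; if_then_else_)
open import Data.Fin using (Fin; toℕ)
open import Data.List using (List; []; _∷_; map; length; allFin)
open import Data.List.Membership.Propositional using (_∈_)
open import Data.List.Relation.Unary.AllPairs using (AllPairs)
open import Data.List.Relation.Unary.Unique.Propositional using (Unique)
open import Data.Maybe using (Maybe; just; nothing)
open import Data.Nat using (ℕ; zero; suc; pred; _+_; _≤_; _≥_; _≡ᵇ_; _<ᵇ_)
open import Data.Nat.ListAction using (sum)
open import Data.Product using (Σ-syntax; _×_; _,_; swap)
open import Data.Sum using (_⊎_)
open import Function using (_∘_)
open import Relation.Binary.Construct.Closure.ReflexiveTransitive using (Star; ε; _◅_)
open import Relation.Binary.Construct.Closure.Transitive using (TransClosure)
open import Relation.Binary.PropositionalEquality using (_≡_; _≢_)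
open import Relation.Nullary using (¬_)

------------------------------------------------------------------------
-- Directed acyclic graphs and junctions

record DAG (n : ℕ) : Set where
  field
    adj        : Fin n → List (Fin n)
    adj-unique : ∀ u → Unique (adj u)

  infix 4 _⟶_

  _⟶_ : Fin n → Fin n → Set
  u ⟶ v = v ∈ adj u

  field
    acyclic : ∀ v → ¬ TransClosure _⟶_ v v

  Path : Fin n → Fin n → Set
  Path = Star _⟶_

  vertices : ∀ {u v} → Path u v → List (Fin n)
  vertices {u} ε       = u ∷ []
  vertices {u} (_ ◅ p) = u ∷ vertices p

  arcs : ℕ
  arcs = sum (map (length ∘ adj) (allFin n))

  InternallyDisjoint : ∀ {s u v} → Path s u → Path s v → Set
  InternallyDisjoint {s} P Q = ∀ x → x ∈ vertices P → x ∈ vertices Q → x ≡ s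

  Junction : Fin n → Fin n → Fin n → Set
  Junction s u v =
    u ≢ v × (Σ[ P ∈ Path s u ] Σ[ Q ∈ Path s v ] InternallyDisjoint P Q)

  -- Pairs are unordered: each one is listed once, in either orientation, so
  -- the number of pairs is the length of the list.
  record ListsJunctionPairs (s : Fin n) (ps : List (Fin n × Fin n)) : Set where
    field
      sound    : ∀ {u v} → (u , v) ∈ ps → Junction s u v
      complete : ∀ {u v} → Junction s u v → (u , v) ∈ ps ⊎ (v , u) ∈ ps
      once     : AllPairs (λ p q → p ≢ q × p ≢ swap q) ps

-- A partition of a set of vertices: rep v is the representative of the block
-- of v, or nothing if v does not belong to the partitioned set.
record DisjointSets (n : ℕ) : Set where
  field
    rep      : Fin n → Maybe (Fin n)
    rep-idem : ∀ {v r} → rep v ≡ just r → rep r ≡ just r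

------------------------------------------------------------------------
-- A random access machine
--
-- A program uses finitely many registers and arrays, both named by numerals.
-- The only arithmetic is successor and predecessor, so a number computed in t
-- steps exceeds the input numbers and the literals of the program by at most
-- t.  Charging one unit per instruction therefore hides no word-level
-- parallelism: every instruction is a constant-time word-RAM operation.

data Test : Set where
  _==_ _<<_ : (x y : ℕ) → Test

infix  6 _≔lit_ _≔reg_ _≔suc_ _≔pred_ _≔_[_] _[_]≔_
infixr 5 _⨾_

data Program : Set where
  _≔lit_  : (x k : ℕ) → Program
  _≔reg_  : (x y : ℕ) → Program
  _≔suc_  : (x y : ℕ) → Program
  _≔pred_ : (x y : ℕ) → Program
  _≔_[_]  : (x a y : ℕ) → Program
  _[_]≔_  : (a x y : ℕ) → Program
  emit    : (x y : ℕ) → Program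
  skip    : Program
  _⨾_     : (p q : Program) → Program
  If_Then_Else_ : Test → (p q : Program) → Program
  While_Do_     : Test → (p : Program) → Program

Heap : Set
Heap = (a i : ℕ) → ℕ

record State : Set where
  constructor mkState
  field
    reg    : ℕ → ℕ
    heap   : Heap
    output : List (ℕ × ℕ)

open State public

infixl 8 _[_↦_]

_[_↦_] : {A : Set} → (ℕ → A) → ℕ → A → (ℕ → A)
(f [ i ↦ x ]) j = if i ≡ᵇ j then x else f j

setReg : State → ℕ → ℕ → State
setReg σ x k = record σ { reg = reg σ [ x ↦ k ] }

setCell : State → ℕ → ℕ → ℕ → State
setCell σ a i k = record σ { heap = heap σ [ a ↦ heap σ a [ i ↦ k ] ] }

test : Test → State → Bool
test (x == y) σ = reg σ x ≡ᵇ reg σ y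
test (x << y) σ = reg σ x <ᵇ reg σ y

-- Exec p σ t τ: started in σ, the program p halts in τ after t steps.
data Exec : Program → State → ℕ → State → Set where
  lit   : ∀ {x k σ} → Exec (x ≔lit k) σ 1 (setReg σ x k)
  copy  : ∀ {x y σ} → Exec (x ≔reg y) σ 1 (setReg σ x (reg σ y))
  succ  : ∀ {x y σ} → Exec (x ≔suc y) σ 1 (setReg σ x (suc (reg σ y)))
  prec  : ∀ {x y σ} → Exec (x ≔pred y) σ 1 (setReg σ x (pred (reg σ y)))
  load  : ∀ {x a y σ} → Exec (x ≔ a [ y ]) σ 1 (setReg σ x (heap σ a (reg σ y)))
  store : ∀ {a x y σ} → Exec (a [ x ]≔ y) σ 1 (setCell σ a (reg σ x) (reg σ y))
  emit  : ∀ {x y σ} →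
          Exec (emit x y) σ 1 (record σ { output = (reg σ x , reg σ y) ∷ output σ })
  skip  : ∀ {σ} → Exec skip σ 1 σ
  _⨾_   : ∀ {p q σ τ υ t t′} →
          Exec p σ t τ → Exec q τ t′ υ → Exec (p ⨾ q) σ (t + t′) υ
  if-true     : ∀ {b p q σ τ t} → test b σ ≡ true →
                Exec p σ t τ → Exec (If b Then p Else q) σ (suc t) τ
  if-false    : ∀ {b p q σ τ t} → test b σ ≡ false →
                Exec q σ t τ → Exec (If b Then p Else q) σ (suc t) τ
  while-true  : ∀ {b p σ τ υ t t′} → test b σ ≡ true →
                Exec p σ t τ → Exec (While b Do p) τ t′ υ →
                Exec (While b Do p) σ (suc (t + t′)) υ
  while-false : ∀ {b p σ} → test b σ ≡ false →
                Exec (While b Do p) σ 1 σ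

arguments : List ℕ → ℕ → ℕ
arguments []       _       = 0
arguments (k ∷ _)  zero    = k
arguments (_ ∷ ks) (suc i) = arguments ks i

-- A call starts with the arguments in registers 0, 1, …, zeros in all other
-- registers, and an empty output.  Only the heap survives between calls.
Call : ℕ → Program → List ℕ → Heap → (State → Set) → Set
Call bound p args h Post =
  Σ[ t ∈ ℕ ] Σ[ τ ∈ State ]
    Exec p (mkState (arguments args) h []) t τ × t ≤ bound × Post τ

result : State → ℕ
result τ = reg τ 0

------------------------------------------------------------------------
-- Representation of the data

-- 0 is reserved for "no vertex".
code : ∀ {n} → Fin n → ℕ
code v = suc (toℕ v)

code? : ∀ {n} → Maybe (Fin n) → ℕ
code? nothing  = 0
code? (just v) = code v

codes : ∀ {n} → Fin n × Fin n → ℕ × ℕ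
codes (u , v) = code u , code v

-- Linked lists with the end points of the arcs in array 1 and the links in
-- array 2; the pointer 0 is the empty list.
data LinkedList {n : ℕ} (h : Heap) : ℕ → List (Fin n) → Set where
  nil  : LinkedList h 0 []
  cons : ∀ {i v vs} → h 1 (suc i) ≡ code v → LinkedList h (h 2 (suc i)) vs →
         LinkedList h (suc i) (v ∷ vs)

-- G is given by adjacency lists, with list heads in array 0, and all arrays
-- from 3 on are initially zero.
record AdjacencyLists {n : ℕ} (h : Heap) (G : DAG n) : Set where
  field
    lists : ∀ v → LinkedList h (h 0 (code v)) (DAG.adj G v)
    blank : ∀ {a} → a ≥ 3 → ∀ i → h a i ≡ 0

Decides : Set → ℕ → Set
Decides A k = (A × k ≡ 1) ⊎ (¬ A × k ≡ 0)

module Submission where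

-- Call a vertex reached if there is a path to it from s, and label the reached
-- vertices along the arcs as follows.  The label of s is s.  A reached vertex v
-- other than s gets the label v if there is an arc from s to v or if two reached
-- in-neighbours of v have different labels; otherwise all its reached
-- in-neighbours have the same label, and v inherits it.  The blocks of the
-- partition are the classes of reached vertices with the same label.
--
-- The vertex s is a junction of u and v if and only if u and v are reached and
-- have different labels.
--  * Every path from s to v goes through the label of v (rep∈path), and that
--    label is s only if v is s (rep≡root).  Hence, if distinct u and v have the
--    same label, any two paths from s to u and v share a vertex other than s
--    (junction⇒separated).
--  * Conversely, disjoint paths are found by induction along a topological order
--    of the reached vertices (disjoint-paths).  If v is later than u and their
--    labels differ, then v has a reached in-neighbour p whose label differs from
--    that of u, or else u is s and p can be chosen to be s (separating-arc).  By induction there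
--    are disjoint paths to u and p, and the one to p can be extended by v, which
--    is not on the path to u because v is later than all vertices of that path.
--
-- The partition is built in three passes.  A depth-first search from s lists the
-- reached vertices in topological order; acyclicity makes all out-neighbours of a
-- vertex finished when the vertex itself is (search-pop).  Then the labels are
-- propagated along the arcs in this order (relabel and the relax lemmas).
-- Finally the vertices are inserted one by one into a single linked list, in which
-- every block is contiguous and starts with its representative: a representative
-- is inserted after s, any other vertex after its label (grouping-insert).
-- Every reached vertex but s is pushed on the stack by an arc of its own, so at
-- most arcs + 1 vertices are reached, and the time does not depend on n.
--
-- Printing walks along the grouped list and pairs each vertex with all vertices
-- of the earlier blocks.  Since the block of s comes first and is a singleton,
-- every vertex but s belongs to at least one printed pair as its first component,
-- which pays for the walk (print-loop).

open import Defs
open import Data.Bool using (true; false; T)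
open import Data.Empty using (⊥-elim)
open import Data.Fin using (Fin)
open import Data.Fin.Properties using (_≟_; toℕ-injective)
open import Data.List using (List; []; _∷_; map; length; allFin)
open import Data.List.Membership.Propositional using (_∈_; _∉_)
open import Data.List.Membership.Propositional.Properties using (∈-allFin)
open import Data.List.Relation.Unary.All as All using (All; []; _∷_)
open import Data.List.Relation.Unary.All.Properties using (All¬⇒¬Any; ¬Any⇒All¬)
open import Data.List.Relation.Unary.AllPairs using (AllPairs; []; _∷_)
open import Data.List.Relation.Unary.Any using (here; there)
open import Data.List.Relation.Unary.Linked as Linked using (Linked; []; [-]; _∷_)
open import Data.List.Relation.Unary.Unique.Propositional using (Unique)
open import Data.List.Relation.Unary.Unique.Propositional.Properties using (allFin⁺)
open import Data.Maybe using (Maybe; just; nothing)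
open import Data.Maybe.Properties using (just-injective; ≡-dec)
open import Data.Nat using (ℕ; zero; suc; _+_; _*_; _≤_; z≤n; s≤s; s≤s⁻¹; _≡ᵇ_; _<ᵇ_)
open import Data.Nat.ListAction using (sum)
open import Data.Nat.Properties hiding (_≟_)
open import Data.Nat.Tactic.RingSolver using (solve-∀)
open import Data.Product using (Σ-syntax; ∃-syntax; _×_; _,_; proj₁; proj₂; swap)
open import Data.Sum as Sum using (_⊎_; inj₁; inj₂)
open import Function using (_∘_; _$_)
open import Relation.Binary.Construct.Closure.ReflexiveTransitive using (ε; _◅_; _◅◅_)
open import Relation.Binary.Construct.Closure.Transitive using (TransClosure; [_]; _∷_)
open import Relation.Binary.PropositionalEquality
  using (_≡_; _≢_; refl; sym; trans; cong; cong₂; subst; module ≡-Reasoning)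
open import Relation.Nullary using (¬_; yes; no; contradiction)

-- Arrays and vertex-indexed functions

nothing≢just : ∀ {A : Set} {x : A} → nothing ≢ just x
nothing≢just ()

≡ᵇ-true : ∀ {i j} → i ≡ j → (i ≡ᵇ j) ≡ true
≡ᵇ-true {i} {j} e with i ≡ᵇ j | ≡⇒≡ᵇ i j e
... | true | _ = refl

≡ᵇ-false : ∀ {i j} → i ≢ j → (i ≡ᵇ j) ≡ false
≡ᵇ-false {i} {j} ne with i ≡ᵇ j in eq
... | false = refl
... | true  = contradiction (≡ᵇ⇒≡ i j (subst T (sym eq) _)) ne

read-same : ∀ {A : Set} (f : ℕ → A) {i j x} → i ≡ j → (f [ i ↦ x ]) j ≡ x
read-same f {i} {j} e rewrite ≡ᵇ-true e = refl

read-other : ∀ {A : Set} (f : ℕ → A) {i j x} → i ≢ j → (f [ i ↦ x ]) j ≡ f j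
read-other f ne rewrite ≡ᵇ-false ne = refl

code-injective : ∀ {n} {u v : Fin n} → code u ≡ code v → u ≡ v
code-injective = toℕ-injective ∘ suc-injective

-- Pointwise update of a function on vertices; _[_↦_] is the same for arrays.
set : ∀ {n} {A : Set} → (Fin n → A) → Fin n → A → Fin n → A
set f v x w with v ≟ w
... | yes _ = x
... | no  _ = f w

set-same : ∀ {n} {A : Set} (f : Fin n → A) v {x} → set f v x v ≡ x
set-same f v with v ≟ v
... | yes _  = refl
... | no v≢v = contradiction refl v≢v

set-other : ∀ {n} {A : Set} (f : Fin n → A) {v w x} → w ≢ v → set f v x w ≡ f w
set-other f {v} {w} w≢v with v ≟ w
... | yes refl = contradiction refl w≢v
... | no _     = refl

-- The cells of f at the codes of the vertices hold a partial vertex labelling.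
Stores : ∀ {n} → (ℕ → ℕ) → (Fin n → Maybe (Fin n)) → Set
Stores f lab = ∀ v → f (code v) ≡ code? (lab v)

Stores-set : ∀ {n} {f : ℕ → ℕ} {lab : Fin n → Maybe (Fin n)} {i k v m} → Stores f lab →
             i ≡ code v → k ≡ code? m → Stores (f [ i ↦ k ]) (set lab v m)
Stores-set {f = f} {v = v} st refl refl w with v ≟ w
... | yes refl = read-same f refl
... | no  v≢w  = trans (read-other f (v≢w ∘ code-injective)) (st w)

-- Chain f p vs: following the links f from the pointer p visits the vertices vs.
-- The cells are indexed by the codes of the vertices themselves, and 0 is the end.
-- The pointers are constrained by equations, so that they need not be literally
-- of the form code v.
data Chain {n : ℕ} (f : ℕ → ℕ) : ℕ → List (Fin n) → Set where
  nil  : ∀ {p} → p ≡ 0 → Chain f p []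
  cons : ∀ {p v vs} → p ≡ code v → Chain f (f p) vs → Chain f p (v ∷ vs)

Chain-set : ∀ {n} {f : ℕ → ℕ} {p i k v} {vs : List (Fin n)} → i ≡ code v → v ∉ vs →
            Chain f p vs → Chain (f [ i ↦ k ]) p vs
Chain-set e v∉ (nil e′) = nil e′
Chain-set {f = f} refl v∉ (cons refl c) = cons refl
  (subst (λ q → Chain _ q _) (sym (read-other f (v∉ ∘ here ∘ code-injective)))
    (Chain-set refl (v∉ ∘ there) c))

-- Linking a new vertex i to the old head p pushes it on the chain.
Chain-push : ∀ {n} {f : ℕ → ℕ} {p i v} {vs : List (Fin n)} → i ≡ code v → v ∉ vs →
             Chain f p vs → Chain (f [ i ↦ p ]) i (v ∷ vs)
Chain-push {f = f} {p} {i} e v∉ c = cons e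
  (subst (λ q → Chain (f [ i ↦ p ]) q _) (sym (read-same f refl)) (Chain-set e v∉ c))

-- Sums over vertices

-- If f and g agree except at v, exchanging f v for g v turns one sum into the other;
-- the equation avoids subtraction.
sum-replace : ∀ {A : Set} {f g : A → ℕ} {v xs} → (∀ {x} → x ≢ v → f x ≡ g x) →
              Unique xs → v ∈ xs → f v + sum (map g xs) ≡ g v + sum (map f xs)
sum-replace {f = f} {g} {v} {x ∷ xs} h (x∉ ∷ _) (here refl) =
  begin
    f v + (g v + sum (map g xs)) ≡⟨ +-assoc (f v) (g v) _ ⟨
    f v + g v + sum (map g xs)   ≡⟨ cong₂ _+_ (+-comm (f v) (g v)) (sym (same xs x∉)) ⟩
    g v + f v + sum (map f xs)   ≡⟨ +-assoc (g v) (f v) _ ⟩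
    g v + (f v + sum (map f xs)) ∎
  where
  open ≡-Reasoning
  same : ∀ ys → All (v ≢_) ys → sum (map f ys) ≡ sum (map g ys)
  same []       []       = refl
  same (y ∷ ys) (n ∷ ns) = cong₂ _+_ (h (n ∘ sym)) (same ys ns)
sum-replace {f = f} {g} {v} {x ∷ xs} h (x∉ ∷ u) (there i) =
  begin
    f v + (g x + sum (map g xs)) ≡⟨ swap-left (f v) (g x) _ ⟩
    g x + (f v + sum (map g xs)) ≡⟨ cong₂ _+_ (sym (h (All.lookup x∉ i))) (sum-replace h u i) ⟩
    f x + (g v + sum (map f xs)) ≡⟨ swap-left (f x) (g v) _ ⟩
    g v + (f x + sum (map f xs)) ∎
  where
  open ≡-Reasoning
  swap-left : ∀ a b c → a + (b + c) ≡ b + (a + c)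
  swap-left a b c = trans (sym (+-assoc a b c)) (trans (cong (_+ c) (+-comm a b)) (+-assoc b a c))

total : ∀ {n} → (Fin n → ℕ) → ℕ
total {n} f = sum (map f (allFin n))

total-replace : ∀ {n} {f g : Fin n → ℕ} {v} → (∀ {x} → x ≢ v → f x ≡ g x) →
                f v + total g ≡ g v + total f
total-replace {n} {v = v} h = sum-replace h (allFin⁺ n) (∈-allFin v)

sum≤total : ∀ {n} (f : Fin n → ℕ) {vs} → Unique vs → sum (map f vs) ≤ total f
sum≤total f []       = z≤n
sum≤total {n} f {v ∷ vs} (v∉ ∷ u) = begin
  f v + sum (map f vs) ≡⟨ cong (f v +_) (same vs v∉) ⟩
  f v + sum (map g vs) ≤⟨ +-monoʳ-≤ (f v) (sum≤total g u) ⟩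
  f v + total g        ≡⟨ total-replace {f = f} {g} {v} (λ x≢v → sym (set-other f x≢v)) ⟩
  g v + total f        ≡⟨ cong (_+ total f) (set-same f v) ⟩
  total f              ∎
  where
  open ≤-Reasoning
  g : Fin n → ℕ
  g = set f v 0
  same : ∀ ws → All (v ≢_) ws → sum (map f ws) ≡ sum (map g ws)
  same []       []       = refl
  same (w ∷ ws) (n ∷ ns) = cong₂ _+_ (sym (set-other f (n ∘ sym))) (same ws ns)

-- Runs within a time bound

-- A run of p from σ that halts within b steps in a state satisfying Q; a call is a
-- run from the initial state of the call.
Run : Program → State → ℕ → (State → Set) → Set
Run p σ b Q = Σ[ t ∈ ℕ ] Σ[ τ ∈ State ] Exec p σ t τ × t ≤ b × Q τ

finish : ∀ {p σ t τ b} {Q : State → Set} → Exec p σ t τ → t ≤ b → Q τ → Run p σ b Q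
finish e t≤b q = _ , _ , e , t≤b , q

Run-weaken : ∀ {p σ b b′} {Q : State → Set} → b ≤ b′ → Run p σ b Q → Run p σ b′ Q
Run-weaken b≤b′ (_ , _ , e , t≤b , q) = _ , _ , e , ≤-trans t≤b b≤b′ , q

infixr 5 _⨾ʳ_

_⨾ʳ_ : ∀ {p q σ t τ b} {Q : State → Set} → Exec p σ t τ → Run q τ b Q → Run (p ⨾ q) σ (t + b) Q
_⨾ʳ_ {t = t} e (_ , _ , e′ , t≤b , q) = _ , _ , e ⨾ e′ , +-monoʳ-≤ t t≤b , q

Run-seq : ∀ {p q σ b b′} {Q Q′ : State → Set} → Run p σ b Q →
          (∀ {τ} → Q τ → Run q τ b′ Q′) → Run (p ⨾ q) σ (b + b′) Q′
Run-seq (_ , _ , e , t≤b , q) k with k q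
... | _ , _ , e′ , t≤b′ , q′ = _ , _ , e ⨾ e′ , +-mono-≤ t≤b t≤b′ , q′

Run-map : ∀ {p σ b} {Q Q′ : State → Set} → (∀ {τ} → Q τ → Q′ τ) → Run p σ b Q → Run p σ b Q′
Run-map f (_ , _ , e , t≤b , q) = _ , _ , e , t≤b , f q

Run-then : ∀ {c p q σ b} {Q : State → Set} → test c σ ≡ true → Run p σ b Q →
           Run (If c Then p Else q) σ (suc b) Q
Run-then c (_ , _ , e , t≤b , q) = _ , _ , if-true c e , s≤s t≤b , q

Run-else : ∀ {c p q σ b} {Q : State → Set} → test c σ ≡ false → Run q σ b Q →
           Run (If c Then p Else q) σ (suc b) Q
Run-else c (_ , _ , e , t≤b , q) = _ , _ , if-false c e , s≤s t≤b , q

Run-while : ∀ {c p σ b b′} {Q Q′ : State → Set} → test c σ ≡ true → Run p σ b Q →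
            (∀ {τ} → Q τ → Run (While c Do p) τ b′ Q′) →
            Run (While c Do p) σ (suc (b + b′)) Q′
Run-while c (_ , _ , e , t≤b , q) k with k q
... | _ , _ , e′ , t≤b′ , q′ = _ , _ , while-true c e e′ , s≤s (+-mono-≤ t≤b t≤b′) , q′

-- The bound has the form b + 1 to match the bounds k * c + 1 of loops that make at
-- most k iterations, of at most c steps each.
Run-exit : ∀ {c p σ b} {Q : State → Set} → test c σ ≡ false → Q σ → Run (While c Do p) σ (b + 1) Q
Run-exit {b = b} c q = _ , _ , while-false c , m≤n+m 1 b , q

-- The loops run while 0 < p, that is, while the pointer p is not null.
positive : ∀ {x y k} → x ≡ 0 → y ≡ suc k → (x <ᵇ y) ≡ true
positive refl refl = refl

not-positive : ∀ {x y} → x ≡ 0 → y ≡ 0 → (x <ᵇ y) ≡ false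
not-positive refl refl = refl

-- Insertion into lists

-- Insert v r xs ys: ys arises from xs by inserting v right after an occurrence of r.
data Insert {A : Set} (v r : A) : List A → List A → Set where
  here  : ∀ {ys} → Insert v r (r ∷ ys) (r ∷ v ∷ ys)
  there : ∀ {x ys zs} → Insert v r ys zs → Insert v r (x ∷ ys) (x ∷ zs)

module _ {A : Set} {v r : A} where

  insert : ∀ {xs} → r ∈ xs → ∃[ ys ] Insert v r xs ys
  insert (here refl) = _ , here
  insert (there i)   with insert i
  ... | _ , I = _ , there I

  insert-point : ∀ {xs ys} → Insert v r xs ys → r ∈ xs
  insert-point here      = here refl
  insert-point (there I) = there (insert-point I)

  insert-old : ∀ {xs ys x} → Insert v r xs ys → x ∈ xs → x ∈ ys
  insert-old here      (here e)  = here e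
  insert-old here      (there i) = there (there i)
  insert-old (there I) (here e)  = here e
  insert-old (there I) (there i) = there (insert-old I i)

  insert-new : ∀ {xs ys} → Insert v r xs ys → v ∈ ys
  insert-new here      = there (here refl)
  insert-new (there I) = there (insert-new I)

  insert-split : ∀ {xs ys x} → Insert v r xs ys → x ∈ ys → x ≡ v ⊎ x ∈ xs
  insert-split here      (here e)          = inj₂ (here e)
  insert-split here      (there (here e))  = inj₁ e
  insert-split here      (there (there i)) = inj₂ (there i)
  insert-split (there I) (here e)          = inj₂ (here e)
  insert-split (there I) (there i) with insert-split I i
  ... | inj₁ e = inj₁ e
  ... | inj₂ j = inj₂ (there j)

  insert-unique : ∀ {xs ys} → Insert v r xs ys → v ∉ xs → Unique xs → Unique ys
  insert-unique here v∉ (r∉ ∷ u) =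
    ((λ { refl → v∉ (here refl) }) ∷ r∉) ∷ ¬Any⇒All¬ _ (v∉ ∘ there) ∷ u
  insert-unique {x ∷ xs} (there I) v∉ (x∉ ∷ u) = ¬Any⇒All¬ _ x∉′ ∷ insert-unique I (v∉ ∘ there) u
    where
    x∉′ : x ∉ _
    x∉′ i with insert-split I i
    ... | inj₁ refl = v∉ (here refl)
    ... | inj₂ j    = All¬⇒¬Any x∉ j

  insert-linked : ∀ {R : A → A → Set} {xs ys} → Insert v r xs ys → R r v → (∀ {y} → R r y → R v y) →
                  Linked R xs → Linked R ys
  insert-linked here rv step [-]       = rv ∷ [-]
  insert-linked here rv step (ry ∷ l)  = rv ∷ step ry ∷ l
  insert-linked (there here)      rv step (xy ∷ l) = xy ∷ insert-linked here rv step l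
  insert-linked (there (there I)) rv step (xy ∷ l) = xy ∷ insert-linked (there I) rv step l

-- The two writes that splice the vertex at i into a chain after the vertex at j.
Chain-insert : ∀ {n} {f : ℕ → ℕ} {p i j} {v r : Fin n} {xs ys} → i ≡ code v → j ≡ code r →
               v ∉ xs → Unique xs → Insert v r xs ys → Chain f p xs →
               Chain (f [ i ↦ f j ] [ j ↦ i ]) p ys
Chain-insert {f = f} {v = v} {r} refl refl v∉ (r∉ ∷ _) here (cons refl c) = cons refl
  (subst (λ q → Chain g q _) (sym (read-same f₁ {code r} refl)) (cons refl
    (subst (λ q → Chain g q _)
      (sym (trans (read-other f₁ (λ e → v∉ (here (code-injective (sym e))))) (read-same f refl)))
      (Chain-set refl (All¬⇒¬Any r∉) (Chain-set refl (v∉ ∘ there) c)))))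
  where
  f₁ g : ℕ → ℕ
  f₁ = f [ code v ↦ f (code r) ]
  g  = f₁ [ code r ↦ code v ]
Chain-insert {f = f} {v = v} {r} refl refl v∉ (x∉ ∷ u) (there I) (cons {v = x} refl c) = cons refl
  (subst (λ q → Chain g q _)
    (sym (trans
      (read-other f₁ {x = code v}
        (λ e → All¬⇒¬Any x∉ (subst (_∈ _) (code-injective {u = r} {x} e) (insert-point I))))
      (read-other f (λ e → v∉ (here (code-injective e))))))
    (Chain-insert refl refl (v∉ ∘ there) u I c))
  where
  f₁ g : ℕ → ℕ
  f₁ = f [ code v ↦ f (code r) ]
  g  = f₁ [ code r ↦ code v ]

-- Rows of pairs

-- The pairs of i with the members of the list, put in front of ps one at a time, as
-- a machine emits them.
row : ∀ {A : Set} → A → List A → List (A × A) → List (A × A)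
row i []       ps = ps
row i (j ∷ js) ps = row i js ((i , j) ∷ ps)

-- Different as unordered pairs.
Different : {A : Set} → A × A → A × A → Set
Different p q = p ≢ q × p ≢ swap q

module _ {A : Set} {i : A} where

  length-row : ∀ js {ps : List (A × A)} → length (row i js ps) ≡ length js + length ps
  length-row []       = refl
  length-row (j ∷ js) = trans (length-row js) (+-suc (length js) _)

  row-old : ∀ js {ps : List (A × A)} {q} → q ∈ ps → q ∈ row i js ps
  row-old []       k = k
  row-old (j ∷ js) k = row-old js (there k)

  row-new : ∀ {js} {ps : List (A × A)} {j} → j ∈ js → (i , j) ∈ row i js ps
  row-new {j ∷ js} (here refl) = row-old js (here refl)
  row-new {j ∷ js} (there k)   = row-new k

  row-split : ∀ js {ps : List (A × A)} {u v} → (u , v) ∈ row i js ps → (u ≡ i × v ∈ js) ⊎ (u , v) ∈ ps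
  row-split []       k = inj₂ k
  row-split (j ∷ js) k with row-split js k
  ... | inj₁ (e , k′)       = inj₁ (e , there k′)
  ... | inj₂ (here refl)    = inj₁ (refl , here refl)
  ... | inj₂ (there k′)     = inj₂ k′

  row-once : ∀ {js} {ps : List (A × A)} → Unique js → i ∉ js →
             (∀ {j} → j ∈ js → All (Different (i , j)) ps) →
             AllPairs Different ps → AllPairs Different (row i js ps)
  row-once []       _  _     once = once
  row-once {j ∷ js} (j∉ ∷ u) i∉ apart once =
    row-once u (i∉ ∘ there) apart′ (apart (here refl) ∷ once)
    where
    apart′ : ∀ {k} → k ∈ js → All (Different (i , k)) ((i , j) ∷ _)
    apart′ m = ((λ { refl → All¬⇒¬Any j∉ m }) , (λ { refl → i∉ (here refl) })) ∷ apart (there m)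

-- Reachability in an acyclic graph

module Graph {n : ℕ} (G : DAG n) (s : Fin n) where
  open DAG G

  arc-path⇒cycle : ∀ {u v w} → u ⟶ v → Path v w → TransClosure _⟶_ u w
  arc-path⇒cycle a ε       = [ a ]
  arc-path⇒cycle a (b ◅ p) = a ∷ arc-path⇒cycle b p

  no-cycle : ∀ {u v} → u ⟶ v → ¬ Path v u
  no-cycle a p = acyclic _ (arc-path⇒cycle a p)

  infixl 5 _▻_

  _▻_ : ∀ {u v w} → Path u v → v ⟶ w → Path u w
  P ▻ a = P ◅◅ (a ◅ ε)

  ∈-▻ : ∀ {u v w x} (P : Path u v) (a : v ⟶ w) →
        x ∈ vertices (P ▻ a) → x ∈ vertices P ⊎ x ≡ w
  ∈-▻ ε       a (here e)         = inj₁ (here e)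
  ∈-▻ ε       a (there (here e)) = inj₂ e
  ∈-▻ (b ◅ P) a (here e)         = inj₁ (here e)
  ∈-▻ (b ◅ P) a (there i) with ∈-▻ P a i
  ... | inj₁ j = inj₁ (there j)
  ... | inj₂ e = inj₂ e

  head∈ : ∀ {u v} (P : Path u v) → u ∈ vertices P
  head∈ ε       = here refl
  head∈ (_ ◅ _) = here refl

  -- Induction on the last arc of a path from s, whereas Star grows at the front.
  reach-ind : (Q : Fin n → Set) → Q s →
              (∀ {p v} → Path s p → p ⟶ v → Q p → Q v) →
              ∀ {v} → Path s v → Q v
  reach-ind Q base step = go ε base
    where
    go : ∀ {x v} → Path s x → Q x → Path x v → Q v
    go _ q ε       = q
    go P q (a ◅ R) = go (P ▻ a) (step P a q) R

  last-arc : ∀ {v} → Path s v → v ≢ s → ∃[ p ] Path s p × p ⟶ v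
  last-arc = reach-ind (λ v → v ≢ s → ∃[ p ] Path s p × p ⟶ v)
    (λ s≢s → contradiction refl s≢s) (λ P a _ _ → _ , P , a)

  -- Labellings

  -- A vertex without a label has not been reached.
  Labels : Set
  Labels = Fin n → Maybe (Fin n)

  -- Origin E lab v m: the label m of v, a vertex other than s, is the one prescribed by
  -- the arcs of E that enter v and by the labels of their tails.  Here E is the set
  -- of the arcs traversed so far.
  data Origin (E : Fin n → Fin n → Set) (lab : Labels) (v : Fin n) : Maybe (Fin n) → Set where
    untouched : (∀ {p} → ¬ E p v) → Origin E lab v nothing
    from-root : E s v → Origin E lab v (just v)
    merged    : ∀ {p q} → E p v → E q v → lab p ≢ lab q → Origin E lab v (just v)
    inherited : ∀ {p r} → E p v → (∀ {q} → E q v → q ≢ s × lab q ≡ just r) →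
                Origin E lab v (just r)

  -- All labels are as prescribed by the arcs of E.
  record Labelled (E : Fin n → Fin n → Set) (lab : Labels) : Set where
    field
      root   : lab s ≡ just s
      origin : ∀ {v} → v ≢ s → Origin E lab v (lab v)

  Labelled-resp : ∀ {E E′ lab} → (∀ {p v} → E p v → E′ p v) → (∀ {p v} → E′ p v → E p v) →
                  Labelled E lab → Labelled E′ lab
  Labelled-resp {E} {E′} {lab} f g L = record { root = root ; origin = λ v≢s → resp (origin v≢s) }
    where
    open Labelled L
    resp : ∀ {v m} → Origin E lab v m → Origin E′ lab v m
    resp (untouched h)   = untouched (h ∘ g)
    resp (from-root e)   = from-root (f e)
    resp (merged e e′ d) = merged (f e) (f e′) d
    resp (inherited e h) = inherited (f e) (h ∘ g)

  -- The arcs that a complete search from s traverses.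
  Traversed : Fin n → Fin n → Set
  Traversed p v = Path s p × p ⟶ v

  -- Consequences of a labelling along all arcs between reached vertices.  Its labels
  -- are the representatives of the partition.
  module Complete {rep : Labels} (labelled : Labelled Traversed rep) where
    open Labelled labelled

    head≢root : ∀ {p v} → Path s p → p ⟶ v → v ≢ s
    head≢root P a refl = no-cycle a P

    -- All properties of representatives below follow from this one by induction on paths.
    rep-step : ∀ {p v} → Path s p → p ⟶ v → rep v ≡ just v ⊎ (p ≢ s × rep v ≡ rep p)
    rep-step {p} {v} P a with rep v | origin (head≢root P a)
    ... | .nothing  | untouched h   = contradiction (P , a) h
    ... | .(just v) | from-root _   = inj₁ refl
    ... | .(just v) | merged _ _ _  = inj₁ refl
    ... | .(just _) | inherited _ h with h (P , a)
    ...   | p≢s , e = inj₂ (p≢s , sym e)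

    reached⇒labelled : ∀ {v} → Path s v → ∃[ r ] rep v ≡ just r
    reached⇒labelled = reach-ind (λ v → ∃[ r ] rep v ≡ just r) (s , root) step
      where
      step : ∀ {p v} → Path s p → p ⟶ v → ∃[ r ] rep p ≡ just r → ∃[ r ] rep v ≡ just r
      step P a (r , e) with rep-step P a
      ... | inj₁ e′       = _ , e′
      ... | inj₂ (_ , e′) = r , trans e′ e

    labelled⇒reached : ∀ {v r} → rep v ≡ just r → Path s v
    labelled⇒reached {v} e with v ≟ s
    ... | yes refl = ε
    ... | no v≢s with rep v | origin v≢s | e
    ...   | .(just v) | from-root (P , a)    | refl = P ▻ a
    ...   | .(just v) | merged (P , a) _ _   | refl = P ▻ a
    ...   | .(just _) | inherited (P , a) _  | refl = P ▻ a

    rep-idem : ∀ {v r} → rep v ≡ just r → rep r ≡ just r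
    rep-idem e = reach-ind (λ v → ∀ {r} → rep v ≡ just r → rep r ≡ just r)
      (λ e′ → subst (λ r → rep r ≡ just r) (just-injective (trans (sym root) e′)) root)
      step (labelled⇒reached e) e
      where
      step : ∀ {p v} → Path s p → p ⟶ v → (∀ {r} → rep p ≡ just r → rep r ≡ just r) →
             ∀ {r} → rep v ≡ just r → rep r ≡ just r
      step P a ih e′ with rep-step P a
      ... | inj₁ e″       = subst (λ r → rep r ≡ just r) (just-injective (trans (sym e″) e′)) e″
      ... | inj₂ (_ , e″) = ih (trans (sym e″) e′)

    rep≡root : ∀ {v} → rep v ≡ just s → v ≡ s
    rep≡root e = reach-ind (λ v → rep v ≡ just s → v ≡ s) (λ _ → refl) step (labelled⇒reached e) e
      where
      step : ∀ {p v} → Path s p → p ⟶ v → (rep p ≡ just s → p ≡ s) → rep v ≡ just s → v ≡ s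
      step P a ih e′ with rep-step P a
      ... | inj₁ e″         = just-injective (trans (sym e″) e′)
      ... | inj₂ (p≢s , e″) = contradiction (ih (trans (sym e″) e′)) p≢s

    -- A path from x to v changes the label only at a vertex that is its own label, so
    -- either the label of v is on the path or x has it already.
    through : ∀ {x v r} → Path s x → (P : Path x v) → rep v ≡ just r →
              r ∈ vertices P ⊎ rep x ≡ just r
    through _ ε       e = inj₂ e
    through R (a ◅ P) e with through (R ▻ a) P e
    ... | inj₁ r∈P = inj₁ (there r∈P)
    ... | inj₂ e′ with rep-step R a
    ...   | inj₁ e″ = inj₁ (there (subst (_∈ vertices P) (just-injective (trans (sym e″) e′)) (head∈ P)))
    ...   | inj₂ (_ , e″) = inj₂ (trans (sym e″) e′)

    rep∈path : ∀ {v r} (P : Path s v) → rep v ≡ just r → r ∈ vertices P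
    rep∈path P e with through ε P e
    ... | inj₁ r∈P = r∈P
    ... | inj₂ e′  = subst (_∈ vertices P) (just-injective (trans (sym root) e′)) (head∈ P)

    -- The criterion for s to be a junction.
    Separated : Fin n → Fin n → Set
    Separated u v = Path s u × Path s v × rep u ≢ rep v

    junction⇒separated : ∀ {u v} → Junction s u v → Separated u v
    junction⇒separated {u} {v} (u≢v , P , Q , disj) = P , Q , differ
      where
      differ : rep u ≢ rep v
      differ e with reached⇒labelled P
      ... | r , e′ with disj r (rep∈path P e′) (rep∈path Q (trans (sym e) e′))
      ...   | refl = u≢v (trans (rep≡root e′) (sym (rep≡root (trans (sym e) e′))))

    -- The pairs to which disjoint paths are built.  The pair s, s is not a junction pair
    -- but belongs here, since extending one of its two trivial paths gives paths to s and v.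
    Apart : Fin n → Fin n → Set
    Apart u v = (u ≡ s × v ≡ s) ⊎ rep u ≢ rep v

    separating-arc : ∀ {u v} → Path s v → v ≢ s → rep u ≢ rep v →
                     ∃[ p ] Path s p × p ⟶ v × Apart u p
    separating-arc {u} {v} P v≢s d with reached⇒labelled P
    ... | r , e with rep v | origin v≢s | e
    ...   | .(just v) | from-root (R , a) | _ with u ≟ s
    ...     | yes u≡s = s , R , a , inj₁ (u≡s , refl)
    ...     | no  u≢s = s , R , a , inj₂ (λ e′ → u≢s (rep≡root (trans e′ root)))
    separating-arc {u} {v} P v≢s d | r , e
          | .(just v) | merged {p} {q} (R , a) (R′ , a′) d′ | _ with ≡-dec _≟_ (rep u) (rep p)
    ...     | yes e′ = q , R′ , a′ , inj₂ (λ e″ → d′ (trans (sym e′) e″))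
    ...     | no  d″ = p , R , a , inj₂ d″
    separating-arc {u} {v} P v≢s d | r , e
          | .(just _) | inherited {p} (R , a) h | _ =
      p , R , a , inj₂ (λ e′ → d (trans e′ (proj₂ (h (R , a)))))

  -- Topological order

  -- A list in topological order that is closed under taking out-neighbours.
  data Sorted : List (Fin n) → Set where
    []  : Sorted []
    _∷_ : ∀ {v vs} → v ∉ vs × (∀ {w} → v ⟶ w → w ∈ vs) → Sorted vs → Sorted (v ∷ vs)

  sorted-closed : ∀ {vs v w} → Sorted vs → v ∈ vs → Path v w → w ∈ vs
  sorted-closed S i ε = i
  sorted-closed S i (a ◅ P) = sorted-closed S (succ∈ S i a) P
    where
    succ∈ : ∀ {vs v w} → Sorted vs → v ∈ vs → v ⟶ w → w ∈ vs
    succ∈ ((_ , f) ∷ _) (here refl) a = there (f a)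
    succ∈ (_ ∷ S)       (there i)   a = there (succ∈ S i a)

  -- The state of a sweep over the reached vertices in topological order: A holds those
  -- that have been processed, in any order, and B those still to come.
  record Split (A B : List (Fin n)) : Set where
    field
      sorted  : Sorted B
      fresh   : ∀ {v} → v ∈ A → v ∉ B
      visited : ∀ {v} → v ∈ A → Path s v
      reached : ∀ {v} → v ∈ B → Path s v
      covers  : ∀ {v} → Path s v → v ∈ A ⊎ v ∈ B

  advance : ∀ {A v B} → Split A (v ∷ B) → Split (v ∷ A) B
  advance {A} {v} {B} S with Split.sorted S
  ... | (v∉B , _) ∷ sorted = record
    { sorted = sorted ; fresh = fresh′ ; visited = visited′ ; reached = reached ∘ there ; covers = covers′ }
    where
    open Split S hiding (sorted)
    fresh′ : ∀ {w} → w ∈ v ∷ A → w ∉ B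
    fresh′ (here refl) = v∉B
    fresh′ (there i)   = fresh i ∘ there
    visited′ : ∀ {w} → w ∈ v ∷ A → Path s w
    visited′ (here refl) = reached (here refl)
    visited′ (there i)   = visited i
    covers′ : ∀ {w} → Path s w → w ∈ v ∷ A ⊎ w ∈ B
    covers′ P with covers P
    ... | inj₁ i           = inj₁ (there i)
    ... | inj₂ (here refl) = inj₁ (here refl)
    ... | inj₂ (there i)   = inj₂ i

  -- In-neighbours are processed first: if p came after v, then so would v.
  split-pred : ∀ {A v B p} → Split A (v ∷ B) → Path s p → p ⟶ v → p ∈ A
  split-pred S P a with Split.covers S P | Split.sorted S
  ... | inj₁ i           | _              = i
  ... | inj₂ (here refl) | _              = ⊥-elim (no-cycle a ε)
  ... | inj₂ (there i)   | (v∉B , _) ∷ T  = contradiction (sorted-closed T i (a ◅ ε)) v∉B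

  -- Any other first vertex would have a reached in-neighbour before it.
  root-first : ∀ {B} → Split [] B → ∃[ B′ ] B ≡ s ∷ B′
  root-first {[]} S with Split.covers S ε
  ... | inj₁ ()
  ... | inj₂ ()
  root-first {v ∷ B} S with v ≟ s
  ... | yes refl = B , refl
  ... | no  v≢s with last-arc (Split.reached S (here refl)) v≢s
  ...   | p , P , a with split-pred S P a
  ...     | ()

  module _ {rep : Labels} (labelled : Labelled Traversed rep) where
    open Complete labelled

    -- Internally disjoint paths within A.  Confining them to A makes every vertex
    -- outside A available for extending them.
    DisjointPaths : List (Fin n) → Fin n → Fin n → Set
    DisjointPaths A u v =
      Σ[ P ∈ Path s u ] Σ[ Q ∈ Path s v ] InternallyDisjoint P Q
        × (∀ {x} → x ∈ vertices P → x ∈ A) × (∀ {x} → x ∈ vertices Q → x ∈ A)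

    flip-paths : ∀ {A u v} → DisjointPaths A u v → DisjointPaths A v u
    flip-paths (P , Q , d , p , q) = Q , P , (λ x i j → d x j i) , q , p

    flip-apart : ∀ {u v} → Apart u v → Apart v u
    flip-apart (inj₁ (a , b)) = inj₁ (b , a)
    flip-apart (inj₂ d)       = inj₂ (d ∘ sym)

    extend-paths : ∀ {A u p v} → v ∉ A → p ⟶ v → DisjointPaths A u p → DisjointPaths (v ∷ A) u v
    extend-paths {A} {u} {p} {v} v∉A a (P , Q , d , inP , inQ) =
      P , Q ▻ a , d′ , there ∘ inP , inQ′
      where
      d′ : InternallyDisjoint P (Q ▻ a)
      d′ x i j with ∈-▻ Q a j
      ... | inj₁ k    = d x i k
      ... | inj₂ refl = contradiction (inP i) v∉A
      inQ′ : ∀ {x} → x ∈ vertices (Q ▻ a) → x ∈ v ∷ A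
      inQ′ j with ∈-▻ Q a j
      ... | inj₁ k = there (inQ k)
      ... | inj₂ e = here e

    -- The induction along the topological order: A is extended by one vertex at a time
    -- until it holds all reached vertices.
    disjoint-paths : ∀ {A B} → Split A B → s ∈ A →
      (∀ {u v} → u ∈ A → v ∈ A → Apart u v → DisjointPaths A u v) →
      ∀ {u v} → Path s u → Path s v → Apart u v → ∃[ C ] DisjointPaths C u v
    disjoint-paths {A} {[]} S s∈A ih P Q d with Split.covers S P | Split.covers S Q
    ... | inj₁ i | inj₁ j = A , ih i j d
    disjoint-paths {A} {x ∷ B} S s∈A ih = disjoint-paths (advance S) (there s∈A) ih′
      where
      x∉A : x ∉ A
      x∉A i = Split.fresh S i (here refl)

      x≢s : x ≢ s
      x≢s refl = x∉A s∈A

      weaken : ∀ {u v} → DisjointPaths A u v → DisjointPaths (x ∷ A) u v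
      weaken (P , Q , d , p , q) = P , Q , d , there ∘ p , there ∘ q

      new : ∀ {u} → u ∈ A → Apart u x → DisjointPaths (x ∷ A) u x
      new i (inj₁ (_ , x≡s)) = contradiction x≡s x≢s
      new i (inj₂ d) with separating-arc (Split.reached S (here refl)) x≢s d
      ... | p , R , a , d′ = extend-paths x∉A a (ih i (split-pred S R a) d′)

      ih′ : ∀ {u v} → u ∈ x ∷ A → v ∈ x ∷ A → Apart u v → DisjointPaths (x ∷ A) u v
      ih′ (here refl) (here refl) (inj₁ (x≡s , _)) = contradiction x≡s x≢s
      ih′ (here refl) (here refl) (inj₂ d) = contradiction refl d
      ih′ (here refl) (there j)   d = flip-paths (new j (flip-apart d))
      ih′ (there i)   (here refl) d = new i d
      ih′ (there i)   (there j)   d = weaken (ih i j d)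

    separated⇒junction : ∀ {B} → Split (s ∷ []) B → ∀ {u v} → Separated u v → Junction s u v
    separated⇒junction S (P , Q , d) with disjoint-paths S (here refl) base P Q (inj₂ d)
      where
      base : ∀ {u v} → u ∈ s ∷ [] → v ∈ s ∷ [] → Apart u v → DisjointPaths (s ∷ []) u v
      base (here refl) (here refl) _ = ε , ε , (λ { x (here e) _ → e }) , (λ i → i) , (λ i → i)
    ... | _ , P′ , Q′ , disj , _ = (λ u≡v → d (cong rep u≡v)) , P′ , Q′ , disj

  -- Traversing one more arc

  -- E′ is E together with the arc from u to v.  No arc of E leaves v, so the label of
  -- v has not yet been used for any other vertex and may still change.
  module Relabel {E E′ : Fin n → Fin n → Set} {u v : Fin n} (old : ∀ {p w} → E p w → E′ p w)
    (split : ∀ {p w} → E′ p w → E p w ⊎ (p ≡ u × w ≡ v)) (new : E′ u v)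
    (u≢v : u ≢ v) (idle : ∀ {w} → ¬ E v w) where

    relabel : ∀ {lab lab′ : Labels} → v ≢ s → (∀ {w} → w ≢ v → lab′ w ≡ lab w) →
              Origin E′ lab v (lab′ v) → Labelled E lab → Labelled E′ lab′
    relabel {lab} {lab′} v≢s same o L = record
      { root = trans (same (v≢s ∘ sym)) root ; origin = origin′ }
      where
      open Labelled L

      tail≢v : ∀ {p w} → E′ p w → p ≢ v
      tail≢v e refl with split e
      ... | inj₁ e′         = idle e′
      ... | inj₂ (v≡u , _)  = u≢v (sym v≡u)

      -- The arcs of E′ leave vertices other than v, so their tails keep their labels.
      keep : ∀ {p w} → E′ p w → lab′ p ≡ lab p
      keep e = same (tail≢v e)

      transport : ∀ {w m} → Origin E′ lab w m → Origin E′ lab′ w m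
      transport (untouched no-arc) = untouched no-arc
      transport (from-root e)      = from-root e
      transport (merged e e′ d)    = merged e e′ (λ eq → d (trans (sym (keep e)) (trans eq (keep e′))))
      transport (inherited e all)  = inherited e (λ e′ → proj₁ (all e′) , trans (keep e′) (proj₂ (all e′)))

      extend : ∀ {w m} → w ≢ v → Origin E lab w m → Origin E′ lab w m
      extend {w} w≢v o = go o
        where
        back : ∀ {p} → E′ p w → E p w
        back e with split e
        ... | inj₁ e′        = e′
        ... | inj₂ (_ , w≡v) = contradiction w≡v w≢v
        go : ∀ {m} → Origin E lab w m → Origin E′ lab w m
        go (untouched no-arc) = untouched (no-arc ∘ back)
        go (from-root e)      = from-root (old e)
        go (merged e e′ d)    = merged (old e) (old e′) d
        go (inherited e all)  = inherited (old e) (all ∘ back)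

      origin′ : ∀ {w} → w ≢ s → Origin E′ lab′ w (lab′ w)
      origin′ {w} w≢s with w ≟ v
      ... | yes refl = transport o
      ... | no  w≢v  = transport (subst (Origin E′ lab w) (sym (same w≢v)) (extend w≢v (origin w≢s)))

    -- The label that v gets from the new arc, in the four cases of the algorithm: u is s;
    -- v has no label; u and v have the same label ℓ; their labels differ.
    relax-root : ∀ {lab} → u ≡ s → Origin E′ lab v (just v)
    relax-root refl = from-root new

    relax-first : ∀ {lab ℓ} → u ≢ s → lab u ≡ just ℓ → Origin E lab v nothing → Origin E′ lab v (just ℓ)
    relax-first {lab} {ℓ} u≢s e (untouched no-arc) = inherited new all
      where
      all : ∀ {q} → E′ q v → q ≢ s × lab q ≡ just ℓ
      all e′ with split e′
      ... | inj₁ a          = contradiction a no-arc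
      ... | inj₂ (refl , _) = u≢s , e

    relax-agree : ∀ {lab ℓ} → u ≢ s → lab u ≡ just ℓ → Origin E lab v (just ℓ) → Origin E′ lab v (just ℓ)
    relax-agree _ _ (from-root e)   = from-root (old e)
    relax-agree _ _ (merged e e′ d) = merged (old e) (old e′) d
    relax-agree {lab} {ℓ} u≢s eq (inherited e all) = inherited (old e) all′
      where
      all′ : ∀ {q} → E′ q v → q ≢ s × lab q ≡ just ℓ
      all′ e′ with split e′
      ... | inj₁ a          = all a
      ... | inj₂ (refl , _) = u≢s , eq

    relax-differ : ∀ {lab ℓ r} → lab u ≡ just ℓ → r ≢ ℓ → Origin E lab v (just r) → Origin E′ lab v (just v)
    relax-differ _ _ (from-root e)   = from-root (old e)
    relax-differ _ _ (merged e e′ d) = merged (old e) (old e′) d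
    relax-differ eq r≢ℓ (inherited e all) = merged (old e) new
      (λ e′ → r≢ℓ (just-injective (trans (sym (proj₂ (all e))) (trans e′ eq))))

  -- Grouping by blocks

  -- In a grouped list, y may come right after x if it starts a new block or continues
  -- the block of x.  The block of s has no other member.
  Follows : Labels → Fin n → Fin n → Set
  Follows rep x y = rep y ≡ just y ⊎ (x ≢ s × rep y ≡ rep x)

  -- A grouped list M of the vertices of A.
  record Grouping (rep : Labels) (A M : List (Fin n)) : Set where
    field
      unique : Unique M
      linked : Linked (Follows rep) M
      root∈  : s ∈ M
      sound  : ∀ {v} → v ∈ M → v ∈ A
      all    : ∀ {v} → v ∈ A → v ∈ M
      closed : ∀ {v r} → v ∈ M → rep v ≡ just r → r ∈ M

  -- Inserting v right after r keeps the list M grouped.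
  InsertionPoint : Labels → List (Fin n) → Fin n → Fin n → Set
  InsertionPoint rep M v r =
    r ∈ M × Follows rep r v × (∀ {y} → Follows rep r y → Follows rep v y)

  sorted-unique : ∀ {B} → Sorted B → Unique B
  sorted-unique []              = []
  sorted-unique ((v∉B , _) ∷ S) = ¬Any⇒All¬ _ v∉B ∷ sorted-unique S

  module _ {rep : Labels} (labelled : Labelled Traversed rep) where
    open Complete labelled

    -- A label other than v itself is inherited from an in-neighbour, which is in M already.
    rep-before : ∀ {A B M v r} → Split A (v ∷ B) → Grouping rep A M → v ≢ s → rep v ≡ just r → r ≢ v → r ∈ M
    rep-before S Γ v≢s e r≢v with last-arc (Split.reached S (here refl)) v≢s
    ... | p , P , a with rep-step P a
    ...   | inj₁ e′       = contradiction (just-injective (trans (sym e) e′)) r≢v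
    ...   | inj₂ (_ , e′) = Grouping.closed Γ (Grouping.all Γ (split-pred S P a)) (trans (sym e′) e)

    own-block : ∀ {M v} → s ∈ M → v ≢ s → rep v ≡ just v → InsertionPoint rep M v s
    own-block i v≢s e = i , inj₁ e , λ { (inj₁ e′) → inj₁ e′ ; (inj₂ (s≢s , _)) → contradiction refl s≢s }

    same-block : ∀ {M v r} → r ∈ M → v ≢ s → rep v ≡ just r → InsertionPoint rep M v r
    same-block {v = v} {r} i v≢s e = i , inj₂ (r≢s , e′) , step
      where
      e′ : rep v ≡ rep r
      e′ = trans e (sym (rep-idem e))
      r≢s : r ≢ s
      r≢s refl = v≢s (rep≡root e)
      step : ∀ {y} → Follows rep r y → Follows rep v y
      step (inj₁ e″)       = inj₁ e″
      step (inj₂ (_ , e″)) = inj₂ (v≢s , trans e″ (sym e′))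

    grouping-insert : ∀ {A B M N v q r} → Split A (v ∷ B) → Grouping rep A M →
      InsertionPoint rep M v q → Insert v q M N → rep v ≡ just r → r ≡ v ⊎ r ∈ M →
      Grouping rep (v ∷ A) N
    grouping-insert {A} {v = v} S Γ (_ , qv , step) I e r∈ = record
      { unique = insert-unique I (λ i → Split.fresh S (sound i) (here refl)) unique
      ; linked = insert-linked I qv step linked
      ; root∈  = insert-old I root∈
      ; sound  = sound′
      ; all    = λ { (here refl) → insert-new I ; (there i) → insert-old I (all i) }
      ; closed = closed′
      }
      where
      open Grouping Γ
      sound′ : ∀ {x} → x ∈ _ → x ∈ v ∷ A
      sound′ i with insert-split I i
      ... | inj₁ refl = here refl
      ... | inj₂ j    = there (sound j)
      rep∈ : ∀ {r} → r ≡ v ⊎ r ∈ _ → r ∈ _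
      rep∈ (inj₁ refl) = insert-new I
      rep∈ (inj₂ i)    = insert-old I i
      closed′ : ∀ {x y} → x ∈ _ → rep x ≡ just y → y ∈ _
      closed′ i e′ with insert-split I i
      ... | inj₂ j    = insert-old I (closed j e′)
      ... | inj₁ refl = subst (_∈ _) (just-injective (trans (sym e) e′)) (rep∈ r∈)

    grouping-start : Grouping rep (s ∷ []) (s ∷ [])
    grouping-start = record
      { unique = [] ∷ [] ; linked = [-] ; root∈ = here refl ; sound = λ i → i ; all = λ i → i
      ; closed = λ { (here refl) e → here (just-injective (trans (sym e) (Labelled.root labelled))) } }

  -- Pairs across blocks

  module Listing {rep : Labels} (labelled : Labelled Traversed rep) where
    open Complete labelled

    -- The pairs ps printed after walking over the vertices V, the last of them being x.
    -- The vertices of P are those of the blocks before the block of x.  While x is s,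
    -- there are no such blocks; from then on, s is in P.
    record Printed (V P : List (Fin n)) (x : Fin n) (ps : List (Fin n × Fin n)) : Set where
      field
        unique   : Unique V
        P-unique : Unique P
        P⊆V      : ∀ {y} → y ∈ P → y ∈ V
        own      : ∀ {y} → y ∈ V → y ∈ P ⊎ rep y ≡ rep x
        other    : ∀ {y} → y ∈ P → rep y ≢ rep x
        root∈V   : s ∈ V
        root∈P   : x ≢ s → s ∈ P
        current  : x ∈ V
        reached  : ∀ {y} → y ∈ V → Path s y
        closed   : ∀ {y r} → y ∈ V → rep y ≡ just r → r ∈ V
        visited  : ∀ {u v} → (u , v) ∈ ps → u ∈ V × v ∈ V
        sound    : ∀ {u v} → (u , v) ∈ ps → Separated u v
        complete : ∀ {u v} → u ∈ V → v ∈ V → rep u ≢ rep v → (u , v) ∈ ps ⊎ (v , u) ∈ ps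
        once     : AllPairs Different ps

    -- The vertices P to be paired with y, where y comes right after the vertices V.
    record Row (V P : List (Fin n)) (y : Fin n) : Set where
      field
        P-unique : Unique P
        P⊆V      : ∀ {z} → z ∈ P → z ∈ V
        own      : ∀ {z} → z ∈ V → z ∈ P ⊎ rep z ≡ rep y
        other    : ∀ {z} → z ∈ P → rep z ≢ rep y
        root∈P   : s ∈ P
        closed   : ∀ {r} → rep y ≡ just r → r ∈ y ∷ V

    -- When y starts a new block, all vertices V belong to earlier blocks, since every
    -- vertex of V has its representative in V.
    row-fresh : ∀ {V P x y ps} → Printed V P x ps → y ∉ V → rep y ≡ just y → Row V V y
    row-fresh {y = y} Π y∉V e = record
      { P-unique = unique ; P⊆V = λ i → i ; own = inj₁
      ; other = λ i e′ → y∉V (closed i (trans e′ e))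
      ; root∈P = root∈V
      ; closed = λ e′ → here (just-injective (trans (sym e′) e)) }
      where open Printed Π

    row-continue : ∀ {V P x y ps} → Printed V P x ps → x ≢ s → rep y ≡ rep x → Row V P y
    row-continue Π x≢s e = record
      { P-unique = P-unique ; P⊆V = P⊆V
      ; own = λ i → Sum.map₂ (λ e′ → trans e′ (sym e)) (own i)
      ; other = λ i e′ → other i (trans e′ e)
      ; root∈P = root∈P x≢s
      ; closed = λ e′ → there (closed current (trans (sym e) e′)) }
      where open Printed Π

    print-row-pairs : ∀ {V P P′ x y ps} → Printed V P x ps → Row V P′ y → y ∉ V → Path s y →
                      Printed (y ∷ V) P′ y (row y P′ ps)
    print-row-pairs {V} {P} {P′} {x} {y} {ps} Π ρ y∉V path = record
      { unique   = ¬Any⇒All¬ _ y∉V ∷ unique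
      ; P-unique = Row.P-unique ρ
      ; P⊆V      = there ∘ Row.P⊆V ρ
      ; own      = λ { (here refl) → inj₂ refl ; (there i) → Row.own ρ i }
      ; other    = Row.other ρ
      ; root∈V   = there root∈V
      ; root∈P   = λ _ → Row.root∈P ρ
      ; current  = here refl
      ; reached  = reached′
      ; closed   = λ { (here refl) e → Row.closed ρ e ; (there i) e → there (closed i e) }
      ; visited  = visited′
      ; sound    = sound′
      ; complete = complete′
      ; once     = row-once (Row.P-unique ρ) (y∉V ∘ Row.P⊆V ρ) (λ _ → All.tabulate apart) once
      }
      where
      open Printed Π
      reached′ : ∀ {z} → z ∈ y ∷ V → Path s z
      reached′ (here refl) = path
      reached′ (there i)   = reached i
      visited′ : ∀ {u v} → (u , v) ∈ row y P′ ps → u ∈ y ∷ V × v ∈ y ∷ V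
      visited′ i with row-split P′ i
      ... | inj₁ (refl , j) = here refl , there (Row.P⊆V ρ j)
      ... | inj₂ j          = there (proj₁ (visited j)) , there (proj₂ (visited j))
      sound′ : ∀ {u v} → (u , v) ∈ row y P′ ps → Separated u v
      sound′ i with row-split P′ i
      ... | inj₁ (refl , j) = path , reached (Row.P⊆V ρ j) , (λ e → Row.other ρ j (sym e))
      ... | inj₂ j          = sound j
      partner : ∀ {v} → v ∈ V → rep y ≢ rep v → (y , v) ∈ row y P′ ps
      partner j d with Row.own ρ j
      ... | inj₁ k = row-new k
      ... | inj₂ e = contradiction (sym e) d
      complete′ : ∀ {u v} → u ∈ y ∷ V → v ∈ y ∷ V → rep u ≢ rep v →
                  (u , v) ∈ row y P′ ps ⊎ (v , u) ∈ row y P′ ps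
      complete′ (here refl) (here refl) d = contradiction refl d
      complete′ (here refl) (there j)   d = inj₁ (partner j d)
      complete′ (there i)   (here refl) d = inj₂ (partner i (d ∘ sym))
      complete′ (there i)   (there j)   d with complete i j d
      ... | inj₁ k = inj₁ (row-old P′ k)
      ... | inj₂ k = inj₂ (row-old P′ k)
      apart : ∀ {j q} → q ∈ ps → Different (y , j) q
      apart i = (λ { refl → y∉V (proj₁ (visited i)) }) , (λ { refl → y∉V (proj₂ (visited i)) })

    print-start : Printed (s ∷ []) [] s []
    print-start = record
      { unique = [] ∷ [] ; P-unique = [] ; P⊆V = λ ()
      ; own = λ { (here refl) → inj₂ refl } ; other = λ ()
      ; root∈V = here refl ; root∈P = λ s≢s → contradiction refl s≢s ; current = here refl
      ; reached = λ { (here refl) → ε }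
      ; closed = λ { (here refl) e → here (just-injective (trans (sym e) (Labelled.root labelled))) }
      ; visited = λ () ; sound = λ ()
      ; complete = λ { (here refl) (here refl) d → contradiction refl d }
      ; once = [] }

    -- The rest M of the grouped list, after V, whose last vertex is x.
    record Walk (V : List (Fin n)) (x : Fin n) (M : List (Fin n)) : Set where
      field
        linked  : Linked (Follows rep) (x ∷ M)
        unique  : Unique M
        fresh   : ∀ {y} → y ∈ V → y ∉ M
        reached : ∀ {y} → y ∈ M → Path s y
        covers  : ∀ {y} → Path s y → y ∈ V ⊎ y ∈ M

    walk-step : ∀ {V x y M} → Walk V x (y ∷ M) → Walk (y ∷ V) y M
    walk-step {V} {x} {y} {M} W with Walk.linked W | Walk.unique W
    ... | _ ∷ l | y∉ ∷ u = record
      { linked = l ; unique = u ; fresh = fresh′ ; reached = reached ∘ there ; covers = covers′ }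
      where
      open Walk W
      fresh′ : ∀ {z} → z ∈ y ∷ V → z ∉ M
      fresh′ (here refl) = All¬⇒¬Any y∉
      fresh′ (there i)   = fresh i ∘ there
      covers′ : ∀ {z} → Path s z → z ∈ y ∷ V ⊎ z ∈ M
      covers′ P with covers P
      ... | inj₁ i           = inj₁ (there i)
      ... | inj₂ (here refl) = inj₁ (here refl)
      ... | inj₂ (there i)   = inj₂ i

    lists-pairs : ∀ {L V P x ps} → Split (s ∷ []) L → Printed V P x ps → Walk V x [] → ListsJunctionPairs s ps
    lists-pairs S Π W = record
      { sound    = separated⇒junction labelled S ∘ sound
      ; complete = λ J → let (P , Q , d) = junction⇒separated J in complete (covered P) (covered Q) d
      ; once     = once
      }
      where
      open Printed Π
      covered : ∀ {v} → Path s v → v ∈ _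
      covered P with Walk.covers W P
      ... | inj₁ i = i

-- The machine programs

-- Registers of the construction.  The first two arguments of the call, in registers
-- 0 and 1, are not needed; register 3 is never written and stays 0.
rRoot rZero rTop rOrder rArc rTarget rTemp rOne rVertex rLabel : ℕ
rRoot   = 2
rZero   = 3
rTop    = 4   -- head of the stack
rOrder  = 5   -- head of the list of finished vertices
rArc    = 6
rTarget = 7
rTemp   = 8
rOne    = 9
rVertex = 10
rLabel  = 11

-- Arrays.  The first three hold the graph, and all but those are initially zero.
aHead aEnd aNext aStack aOrder aRest aSeen aRep aGroup aPrinted : ℕ
aHead    = 0
aEnd     = 1
aNext    = 2
aStack   = 3   -- links of the stack
aOrder   = 4   -- links of the list of finished vertices
aRest    = 5   -- arcs not yet scanned
aSeen    = 6   -- 1 for the vertices that have been on the stack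
aRep     = 7   -- labels
aGroup   = 8   -- links of the grouped list
aPrinted = 9   -- links between the vertices visited in printing

takeArc : Program
takeArc = rTarget ≔ aEnd [ rArc ] ⨾ rTemp ≔ aNext [ rArc ] ⨾ aRest [ rTop ]≔ rTemp ⨾
          rTemp ≔ aSeen [ rTarget ]

pushTarget : Program
pushTarget = aSeen [ rTarget ]≔ rOne ⨾ aStack [ rTarget ]≔ rTop ⨾
             rTemp ≔ aHead [ rTarget ] ⨾ aRest [ rTarget ]≔ rTemp ⨾ rTop ≔reg rTarget

popTop : Program
popTop = aOrder [ rTop ]≔ rOrder ⨾ rOrder ≔reg rTop ⨾ rTop ≔ aStack [ rTop ]

-- Scans the next arc of the vertex on top of the stack, pushing the end point if it
-- is new; if no arc is left, moves the vertex to the front of the finished ones.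
searchBody : Program
searchBody =
  rArc ≔ aRest [ rTop ] ⨾
  If rArc == rZero Then popTop
    Else (takeArc ⨾ If rTemp == rZero Then pushTarget Else skip)

search : Program
search =
  rOne ≔lit 1 ⨾ aSeen [ rRoot ]≔ rOne ⨾ rTemp ≔ aHead [ rRoot ] ⨾ aRest [ rRoot ]≔ rTemp ⨾
  rTop ≔reg rRoot ⨾ While rZero << rTop Do searchBody

-- Adjusts the label of the end point of the current arc, which leaves rVertex.
relaxBody : Program
relaxBody =
  rTarget ≔ aEnd [ rArc ] ⨾ rArc ≔ aNext [ rArc ] ⨾ rTemp ≔ aRep [ rTarget ] ⨾
  If rVertex == rRoot Then aRep [ rTarget ]≔ rTarget Else (
  If rTemp == rZero Then aRep [ rTarget ]≔ rLabel Else (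
  If rTemp == rLabel Then skip Else (aRep [ rTarget ]≔ rTarget)))

labelBody : Program
labelBody =
  rArc ≔ aHead [ rVertex ] ⨾ rLabel ≔ aRep [ rVertex ] ⨾
  While rZero << rArc Do relaxBody ⨾
  rVertex ≔ aOrder [ rVertex ]

label : Program
label = aRep [ rRoot ]≔ rRoot ⨾ rVertex ≔reg rRoot ⨾ While rZero << rVertex Do labelBody

-- Inserts rVertex into the grouped list, right after s or after its label.
groupBody : Program
groupBody =
  rLabel ≔ aRep [ rVertex ] ⨾
  If rLabel == rVertex Then rLabel ≔reg rRoot Else skip ⨾
  rTemp ≔ aGroup [ rLabel ] ⨾ aGroup [ rVertex ]≔ rTemp ⨾ aGroup [ rLabel ]≔ rVertex ⨾
  rVertex ≔ aOrder [ rVertex ]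

group : Program
group = rVertex ≔ aOrder [ rRoot ] ⨾ While rZero << rVertex Do groupBody

buildProgram : Program
buildProgram = search ⨾ label ⨾ group

-- Registers of the printing program; all but pRoot are initially 0.  The chains from
-- pVisited and pOthers share their links: pOthers remembers the head of the visited
-- vertices at the start of the current block.
pRoot pZero pVertex pOthers pTemp pPartner pVisited : ℕ
pRoot    = 0
pZero    = 1
pVertex  = 2
pOthers  = 3
pTemp    = 4
pPartner = 5
pVisited = 6

printRow : Program
printRow = While pZero << pPartner Do (emit pVertex pPartner ⨾ pPartner ≔ aPrinted [ pPartner ])

printBody : Program
printBody =
  (pTemp ≔ aRep [ pVertex ] ⨾ If pTemp == pVertex Then pOthers ≔reg pVisited Else skip) ⨾
  (aPrinted [ pVertex ]≔ pVisited ⨾ pVisited ≔reg pVertex ⨾ pPartner ≔reg pOthers) ⨾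
  printRow ⨾ pVertex ≔ aGroup [ pVertex ]

printProgram : Program
printProgram =
  aPrinted [ pRoot ]≔ pZero ⨾ pVisited ≔reg pRoot ⨾ pVertex ≔ aGroup [ pRoot ] ⨾
  While pZero << pVertex Do printBody

findProgram : Program
findProgram = 0 ≔ aRep [ 0 ]

-- Registers 0 to 4 hold s, u, v and the answers of find on u and v; register 5 is 0.
decideProgram : Program
decideProgram =
  If 3 == 5 Then 0 ≔lit 0 Else (
  If 4 == 5 Then 0 ≔lit 0 Else (
  If 3 == 4 Then 0 ≔lit 0 Else (0 ≔lit 1)))

-- Depth-first search

module Build {n : ℕ} (G : DAG n) (s : Fin n) (h : Heap) (input : AdjacencyLists h G) where
  open DAG G
  open Graph G s
  open AdjacencyLists input

  -- What holds throughout the construction.  It is a product rather than a record, so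
  -- that by computation it holds again after any instruction that writes elsewhere.
  Env : State → Set
  Env σ = reg σ rZero ≡ 0 × reg σ rRoot ≡ code s ×
          heap σ aHead ≡ h aHead × heap σ aEnd ≡ h aEnd × heap σ aNext ≡ h aNext

  -- The state of the search: the stack st, the finished vertices fin, and the arcs rem
  -- not yet scanned, given by their end points for every vertex of the graph.
  record Search (st fin : List (Fin n)) (rem : Fin n → List (Fin n)) : Set where
    field
      st-unique : Unique st
      st-fin    : ∀ {v} → v ∈ st → v ∉ fin
      -- The stack is a path, with its last vertex on top.
      st-path   : Linked (λ v w → w ⟶ v) st
      fin-sort  : Sorted fin
      root-seen : s ∈ st ⊎ s ∈ fin
      reached   : ∀ {v} → v ∈ st ⊎ v ∈ fin → Path s v
      rem-arc   : ∀ {v w} → w ∈ rem v → v ⟶ w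
      scanned   : ∀ {v w} → v ∈ st → v ⟶ w → w ∈ rem v ⊎ w ∈ st ⊎ w ∈ fin
      pristine  : ∀ {v} → v ∉ st → v ∉ fin → rem v ≡ adj v
      -- A vertex is pushed at the cost of an arc, whence the bound on fin.
      budget    : (length st + length fin) + total (length ∘ rem) ≤ suc arcs

  Seen : List (Fin n) → List (Fin n) → Fin n → Set
  Seen st fin v = v ∈ st ⊎ v ∈ fin

  stack-path : ∀ {v vs w} → Linked (λ v w → w ⟶ v) (v ∷ vs) → w ∈ v ∷ vs → Path w v
  stack-path _       (here refl) = ε
  stack-path (a ∷ l) (there i)   = stack-path l i ▻ a

  search-pop : ∀ {v st fin rem} → Search (v ∷ st) fin rem → rem v ≡ [] → Search st (v ∷ fin) rem
  search-pop {v} {st} {fin} {rem} S rem≡[] with Search.st-unique S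
  ... | v∉st ∷ st-unique = record
    { st-unique = st-unique
    ; st-fin    = λ { i (here refl) → All¬⇒¬Any v∉st i ; i (there j) → st-fin (there i) j }
    ; st-path   = Linked.tail st-path
    ; fin-sort  = (st-fin (here refl) , closed) ∷ fin-sort
    ; root-seen = shift root-seen
    ; reached   = reached ∘ unshift
    ; rem-arc   = rem-arc
    ; scanned   = scanned′
    ; pristine  = λ i j → pristine (λ { (here refl) → j (here refl) ; (there k) → i k }) (j ∘ there)
    ; budget    = subst (λ m → m + total (length ∘ rem) ≤ suc arcs)
                    (sym (+-suc (length st) (length fin))) budget
    }
    where
    open Search S hiding (st-unique)

    shift : ∀ {w} → Seen (v ∷ st) fin w → Seen st (v ∷ fin) w
    shift (inj₁ (here refl)) = inj₂ (here refl)
    shift (inj₁ (there i))   = inj₁ i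
    shift (inj₂ i)           = inj₂ (there i)

    unshift : ∀ {w} → Seen st (v ∷ fin) w → Seen (v ∷ st) fin w
    unshift (inj₁ i)           = inj₁ (there i)
    unshift (inj₂ (here refl)) = inj₁ (here refl)
    unshift (inj₂ (there i))   = inj₂ i

    -- An arc from v back to the stack would close a cycle.
    closed : ∀ {w} → v ⟶ w → w ∈ fin
    closed {w} a with scanned (here refl) a
    ... | inj₁ i        = ⊥-elim (∉[] (subst (w ∈_) rem≡[] i))
      where
      ∉[] : w ∉ []
      ∉[] ()
    ... | inj₂ (inj₁ i) = contradiction (stack-path st-path i) (no-cycle a)
    ... | inj₂ (inj₂ i) = i

    scanned′ : ∀ {u w} → u ∈ st → u ⟶ w → w ∈ rem u ⊎ Seen st (v ∷ fin) w
    scanned′ i a with scanned (there i) a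
    ... | inj₁ j = inj₁ j
    ... | inj₂ j = inj₂ (shift j)

  total-consume : ∀ (rem : Fin n → List (Fin n)) v {w ws} → rem v ≡ w ∷ ws →
                  suc (total (length ∘ set rem v ws)) ≡ total (length ∘ rem)
  total-consume rem v {w} {ws} e = +-cancelˡ-≡ (length ws) _ _ (begin
    length ws + suc (total g)           ≡⟨ +-suc (length ws) (total g) ⟩
    suc (length ws) + total g           ≡⟨ cong (λ vs → length vs + total g) e ⟨
    length (rem v) + total g            ≡⟨ total-replace (λ x≢v → cong length (sym (set-other rem x≢v))) ⟩
    length (set rem v ws v) + total (length ∘ rem)
      ≡⟨ cong (λ vs → length vs + total (length ∘ rem)) (set-same rem v) ⟩
    length ws + total (length ∘ rem)    ∎)
    where
    open ≡-Reasoning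
    g : Fin n → ℕ
    g = length ∘ set rem v ws

  -- Scanning the arc from v to w.
  module _ {v st fin rem w ws} (S : Search (v ∷ st) fin rem) (e : rem v ≡ w ∷ ws) where
    open Search S

    rem′ : Fin n → List (Fin n)
    rem′ = set rem v ws

    arc : v ⟶ w
    arc = rem-arc (subst (w ∈_) (sym e) (here refl))

    rem-arc′ : ∀ {u x} → x ∈ rem′ u → u ⟶ x
    rem-arc′ {u} i with v ≟ u
    ... | yes refl = rem-arc (subst (_ ∈_) (sym e) (there i))
    ... | no _     = rem-arc i

    scanned′ : ∀ {u x} → u ∈ v ∷ st → u ⟶ x → x ∈ rem′ u ⊎ x ≡ w ⊎ Seen (v ∷ st) fin x
    scanned′ {u} {x} i a with v ≟ u | scanned i a
    ... | no _     | inj₁ j = inj₁ j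
    ... | no _     | inj₂ j = inj₂ (inj₂ j)
    ... | yes _    | inj₂ j = inj₂ (inj₂ j)
    ... | yes refl | inj₁ j with subst (x ∈_) e j
    ...   | here x≡w = inj₂ (inj₁ x≡w)
    ...   | there k  = inj₁ k

    pristine′ : ∀ {u} → u ∉ v ∷ st → u ∉ fin → rem′ u ≡ adj u
    pristine′ i j = trans (set-other rem (i ∘ here)) (pristine i j)

    search-skip : Seen (v ∷ st) fin w → Search (v ∷ st) fin rem′
    search-skip w-seen = record
      { st-unique = st-unique ; st-fin = st-fin ; st-path = st-path ; fin-sort = fin-sort
      ; root-seen = root-seen ; reached = reached ; rem-arc = rem-arc′
      ; scanned = λ i a → simplify (scanned′ i a)
      ; pristine = pristine′
      ; budget = ≤-trans (+-monoʳ-≤ (length (v ∷ st) + length fin)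
                   (≤-trans (n≤1+n _) (≤-reflexive (total-consume rem v e)))) budget
      }
      where
      simplify : ∀ {A : Set} {x} → A ⊎ x ≡ w ⊎ Seen (v ∷ st) fin x → A ⊎ Seen (v ∷ st) fin x
      simplify (inj₁ a)           = inj₁ a
      simplify (inj₂ (inj₁ refl)) = inj₂ w-seen
      simplify (inj₂ (inj₂ i))    = inj₂ i

    search-push : w ∉ v ∷ st → w ∉ fin → Search (w ∷ v ∷ st) fin rem′
    search-push w∉st w∉fin = record
      { st-unique = ¬Any⇒All¬ _ w∉st ∷ st-unique
      ; st-fin    = λ { (here refl) → w∉fin ; (there i) → st-fin i }
      ; st-path   = arc ∷ st-path
      ; fin-sort  = fin-sort
      ; root-seen = old root-seen
      ; reached   = λ { (inj₁ (here refl)) → reached (inj₁ (here refl)) ▻ arc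
                      ; (inj₁ (there i)) → reached (inj₁ i)
                      ; (inj₂ i) → reached (inj₂ i) }
      ; rem-arc   = rem-arc′
      ; scanned   = scanned″
      ; pristine  = λ i j → pristine′ (i ∘ there) j
      ; budget    = ≤-trans (≤-reflexive (trans (sym (+-suc (length (v ∷ st) + length fin) _))
                      (cong (length (v ∷ st) + length fin +_) (total-consume rem v e)))) budget
      }
      where
      old : ∀ {x} → Seen (v ∷ st) fin x → Seen (w ∷ v ∷ st) fin x
      old (inj₁ i) = inj₁ (there i)
      old (inj₂ i) = inj₂ i

      scanned″ : ∀ {u x} → u ∈ w ∷ v ∷ st → u ⟶ x → x ∈ rem′ u ⊎ Seen (w ∷ v ∷ st) fin x
      scanned″ (here refl) a = inj₁ (subst (_ ∈_) (sym (pristine′ w∉st w∉fin)) a)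
      scanned″ (there i) a with scanned′ i a
      ... | inj₁ j           = inj₁ j
      ... | inj₂ (inj₁ refl) = inj₂ (inj₁ (here refl))
      ... | inj₂ (inj₂ j)    = inj₂ (old j)

  search-split : ∀ {fin rem} → Search [] fin rem → Split [] fin
  search-split {fin} S = record
    { sorted = fin-sort ; fresh = λ () ; visited = λ () ; reached = reached ∘ inj₂
    ; covers = λ P → inj₂ (sorted-closed fin-sort root∈ P) }
    where
    open Search S
    root∈ : s ∈ fin
    root∈ with root-seen
    ... | inj₂ i = i

  -- The cell k of aSeen for v.
  Mark : List (Fin n) → List (Fin n) → Fin n → ℕ → Set
  Mark st fin v k = (k ≡ 0 × v ∉ st × v ∉ fin) ⊎ (k ≡ 1 × Seen st fin v)

  SearchEnv : State → Set
  SearchEnv σ = Env σ × reg σ rOne ≡ 1 × heap σ aRep ≡ h aRep × heap σ aGroup ≡ h aGroup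

  -- The state σ represents the state of the search.
  record Machine (st fin : List (Fin n)) (rem : Fin n → List (Fin n)) (σ : State) : Set where
    field
      env   : SearchEnv σ
      stack : Chain (heap σ aStack) (reg σ rTop) st
      order : Chain (heap σ aOrder) (reg σ rOrder) fin
      rests : ∀ {v} → v ∈ st → LinkedList h (heap σ aRest (code v)) (rem v)
      marks : ∀ v → Mark st fin v (heap σ aSeen (code v))

  SearchDone : State → Set
  SearchDone τ = SearchEnv τ × Σ[ fin ∈ List (Fin n) ] Σ[ rem ∈ (Fin n → List (Fin n)) ]
    Chain (heap τ aOrder) (reg τ rOrder) fin × Search [] fin rem

  -- Every step of the search decreases this number: scanning an arc lowers it by 2, even
  -- if a push then raises it by 1, and a pop lowers it by 1.
  measure : List (Fin n) → (Fin n → List (Fin n)) → ℕ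
  measure st rem = length st + (total (length ∘ rem) + total (length ∘ rem))

  env-zero : ∀ σ → Env σ → reg σ rZero ≡ 0
  env-zero _ (e , _) = e

  env-root : ∀ σ → Env σ → reg σ rRoot ≡ code s
  env-root _ (_ , e , _) = e

  env-list : ∀ σ v → Env σ → LinkedList h (heap σ aHead (code v)) (adj v)
  env-list _ v (_ , _ , e , _) = subst (λ f → LinkedList h (f (code v)) (adj v)) (sym e) (lists v)

  env-end : ∀ σ {i p} {w : Fin n} → Env σ → p ≡ suc i → h aEnd (suc i) ≡ code w → heap σ aEnd p ≡ code w
  env-end _ (_ , _ , _ , e , _) refl e′ = trans (cong (_$ _) e) e′

  env-next : ∀ σ {i p} {ws : List (Fin n)} → Env σ → p ≡ suc i → LinkedList h (h aNext (suc i)) ws →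
             LinkedList h (heap σ aNext p) ws
  env-next _ (_ , _ , _ , _ , e) refl l = subst (λ f → LinkedList h (f _) _) (sym e) l

  -- The array f points to the remaining arcs of the vertices on the stack.
  Rests : (ℕ → ℕ) → (Fin n → List (Fin n)) → List (Fin n) → Set
  Rests f rem st = ∀ {v} → v ∈ st → LinkedList h (f (code v)) (rem v)

  rests-consume : ∀ f rem {st v i k ws} → Rests f rem st → i ≡ code v → LinkedList h k ws →
                  Rests (f [ i ↦ k ]) (set rem v ws) st
  rests-consume f rem {v = v} r refl l {u} j with v ≟ u
  ... | yes refl = subst (λ q → LinkedList h q _) (sym (read-same f refl)) l
  ... | no  v≢u  = subst (λ q → LinkedList h q _) (sym (read-other f (v≢u ∘ code-injective))) (r j)

  rests-push : ∀ f rem {st w i k} → Rests f rem st → w ∉ st → i ≡ code w → LinkedList h k (rem w) →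
               Rests (f [ i ↦ k ]) rem (w ∷ st)
  rests-push f rem r w∉ refl l (here refl) = subst (λ q → LinkedList h q _) (sym (read-same f refl)) l
  rests-push f rem {st} r w∉ refl l (there j) = subst (λ q → LinkedList h q _)
    (sym (read-other f (λ e → w∉ (subst (_∈ st) (sym (code-injective e)) j)))) (r j)

  marks-pop : ∀ {v st fin k u} → Mark (v ∷ st) fin u k → Mark st (v ∷ fin) u k
  marks-pop (inj₁ (e , i , j))          =
    inj₁ (e , i ∘ there , λ { (here refl) → i (here refl) ; (there k) → j k })
  marks-pop (inj₂ (e , inj₁ (here i)))  = inj₂ (e , inj₂ (here i))
  marks-pop (inj₂ (e , inj₁ (there i))) = inj₂ (e , inj₁ i)
  marks-pop (inj₂ (e , inj₂ i))         = inj₂ (e , inj₂ (there i))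

  marks-push : ∀ f {st fin w i k} → (∀ u → Mark st fin u (f (code u))) → i ≡ code w → k ≡ 1 →
               ∀ u → Mark (w ∷ st) fin u ((f [ i ↦ k ]) (code u))
  marks-push f {w = w} m refl refl u with w ≟ u
  ... | yes refl = inj₂ (read-same f refl , inj₁ (here refl))
  ... | no w≢u rewrite read-other f {x = 1} (w≢u ∘ code-injective {u = w} {u}) with m u
  ...   | inj₁ (e , i , j) = inj₁ (e , (λ { (here refl) → w≢u refl ; (there k) → i k }) , j)
  ...   | inj₂ (e , inj₁ i) = inj₂ (e , inj₁ (there i))
  ...   | inj₂ (e , inj₂ i) = inj₂ (e , inj₂ i)

  SearchStep : List (Fin n) → (Fin n → List (Fin n)) → State → Set
  SearchStep st rem τ =
    Σ[ st′ ∈ List (Fin n) ] Σ[ fin′ ∈ List (Fin n) ] Σ[ rem′ ∈ (Fin n → List (Fin n)) ]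
      Search st′ fin′ rem′ × Machine st′ fin′ rem′ τ × suc (measure st′ rem′) ≤ measure st rem

  measure-consume : ∀ st (rem : Fin n → List (Fin n)) v {w ws} → rem v ≡ w ∷ ws →
                    suc (suc (measure st (set rem v ws))) ≡ measure st rem
  measure-consume st rem v {w} {ws} e = begin
    suc (suc (length st + (k + k)))   ≡⟨ cong suc (+-suc (length st) (k + k)) ⟨
    suc (length st + suc (k + k))     ≡⟨ +-suc (length st) (suc (k + k)) ⟨
    length st + suc (suc (k + k))     ≡⟨ cong (λ m → length st + suc m) (+-suc k k) ⟨
    length st + (suc k + suc k)       ≡⟨ cong (λ m → length st + (m + m)) (total-consume rem v e) ⟩
    measure st rem                    ∎
    where
    open ≡-Reasoning
    k : ℕ
    k = total (length ∘ set rem v ws)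

  take-arc : ∀ {v st fin rem w ws i σ} → Machine (v ∷ st) fin rem σ →
    reg σ rArc ≡ suc i → h aEnd (suc i) ≡ code w → LinkedList h (h aNext (suc i)) ws →
    Run takeArc σ 4 (λ τ → Machine (v ∷ st) fin (set rem v ws) τ ×
      reg τ rTarget ≡ code w × reg τ rTemp ≡ heap τ aSeen (reg τ rTarget))
  take-arc {rem = rem} {σ = σ} M arc≡ end list with Machine.stack M
  ... | cons top≡ _ = finish (load ⨾ load ⨾ store ⨾ load) ≤-refl (record
    { env   = env
    ; stack = stack
    ; order = order
    ; rests = rests-consume (heap σ aRest) rem rests top≡ (env-next σ (proj₁ env) arc≡ list)
    ; marks = marks
    } , env-end σ (proj₁ env) arc≡ end , refl)
    where open Machine M

  push-target : ∀ {st fin rem w σ} → Machine st fin rem σ → reg σ rTarget ≡ code w → w ∉ st →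
    rem w ≡ adj w → Run pushTarget σ 5 (Machine (w ∷ st) fin rem)
  push-target {rem = rem} {w} {σ} M w≡ w∉st rem≡ = finish (store ⨾ store ⨾ load ⨾ store ⨾ copy) ≤-refl record
    { env   = env
    ; stack = Chain-push w≡ w∉st stack
    ; order = order
    ; rests = rests-push (heap σ aRest) rem rests w∉st w≡
                (subst (LinkedList h _) (sym rem≡)
                  (subst (λ i → LinkedList h (heap σ aHead i) (adj w)) (sym w≡)
                    (env-list σ w (proj₁ env))))
    ; marks = marks-push (heap σ aSeen) marks w≡ (proj₁ (proj₂ env))
    }
    where open Machine M

  search-body : ∀ {v st fin rem σ} → Search (v ∷ st) fin rem → Machine (v ∷ st) fin rem σ →
                Run searchBody σ 12 (SearchStep (v ∷ st) rem)
  search-body {v} {st} {fin} {rem} {σ} S M with Machine.stack M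
  ... | cons top≡ below = body refl refl
          (subst (λ i → LinkedList h (heap σ aRest i) (rem v)) (sym top≡) (rests (here refl)))
    where
    open Machine M
    open Search S using (st-fin)

    zero≡ : reg σ rZero ≡ 0
    zero≡ = env-zero σ (proj₁ env)

    M′ : Machine (v ∷ st) fin rem (setReg σ rArc (heap σ aRest (reg σ rTop)))
    M′ = record { env = env ; stack = stack ; order = order ; rests = rests ; marks = marks }

    body : ∀ {p vs} → heap σ aRest (reg σ rTop) ≡ p → rem v ≡ vs → LinkedList h p vs →
           Run searchBody σ 12 (SearchStep (v ∷ st) rem)
    body p≡ rem≡ nil = finish
      (load ⨾ if-true (≡ᵇ-true (trans p≡ (sym zero≡))) (store ⨾ copy ⨾ load))
      (m≤m+n 5 7)
      (st , v ∷ fin , rem , search-pop S rem≡ , record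
        { env   = env
        ; stack = below
        ; order = Chain-push top≡ (st-fin (here refl)) order
        ; rests = rests ∘ there
        ; marks = λ u → marks-pop (marks u)
        } , ≤-refl)
    body p≡ rem≡ (cons {v = w} {vs = ws} end list) =
      load ⨾ʳ Run-else (≡ᵇ-false λ e → 1+n≢0 (trans (sym p≡) (trans e zero≡)))
        (Run-seq (take-arc M′ p≡ end list) λ {τ} (T , w≡ , temp≡) → visit τ T w≡ temp≡)
      where
      visit : ∀ τ → Machine (v ∷ st) fin (set rem v ws) τ → reg τ rTarget ≡ code w →
              reg τ rTemp ≡ heap τ aSeen (reg τ rTarget) →
              Run (If rTemp == rZero Then pushTarget Else skip) τ 6 (SearchStep (v ∷ st) rem)
      visit τ T w≡ temp≡ with Machine.marks T w
      ... | inj₂ (marked , w-seen) = Run-weaken (m≤m+n 2 4) (Run-else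
        (≡ᵇ-false λ e → 1+n≢0 (trans (sym (trans seen≡ marked)) (trans e (env-zero τ (proj₁ (Machine.env T))))))
        (finish skip ≤-refl
          (v ∷ st , fin , set rem v ws , search-skip S rem≡ w-seen , T ,
            ≤-trans (n≤1+n _) (≤-reflexive (measure-consume (v ∷ st) rem v rem≡)))))
        where
        seen≡ : reg τ rTemp ≡ heap τ aSeen (code w)
        seen≡ = trans temp≡ (cong (heap τ aSeen) w≡)
      ... | inj₁ (unmarked , w∉st , w∉fin) = Run-then
        (≡ᵇ-true (trans (trans temp≡ (cong (heap τ aSeen) w≡))
          (trans unmarked (sym (env-zero τ (proj₁ (Machine.env T)))))))
        (Run-map (λ T′ → w ∷ v ∷ st , fin , set rem v ws , search-push S rem≡ w∉st w∉fin , T′ ,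
            ≤-reflexive (measure-consume (v ∷ st) rem v rem≡))
          (push-target T w≡ w∉st (pristine′ S rem≡ w∉st w∉fin)))

  search-loop : ∀ k {st fin rem σ} → measure st rem ≤ k → Search st fin rem → Machine st fin rem σ →
                Run (While rZero << rTop Do searchBody) σ (k * 13 + 1) SearchDone
  search-loop k {[]} {fin} {rem} {σ} _ S M with Machine.stack M
  ... | nil top≡ = Run-exit (not-positive (env-zero σ (proj₁ env)) top≡) (env , fin , rem , order , S)
    where open Machine M
  search-loop zero    {_ ∷ _} () S M
  search-loop (suc k) {_ ∷ _} {σ = σ} (s≤s m≤k) S M with Machine.stack M
  ... | cons top≡ _ = Run-while (positive (env-zero σ (proj₁ (Machine.env M))) top≡) (search-body S M)
    (λ { (_ , _ , _ , S′ , M′ , dec) → search-loop k (≤-trans (s≤s⁻¹ dec) m≤k) S′ M′ })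

  start : State
  start = mkState (arguments (n ∷ arcs ∷ code s ∷ [])) h []

  search-start : Search (s ∷ []) [] adj
  search-start = record
    { st-unique = [] ∷ []
    ; st-fin    = λ _ ()
    ; st-path   = [-]
    ; fin-sort  = []
    ; root-seen = inj₁ (here refl)
    ; reached   = λ { (inj₁ (here refl)) → ε }
    ; rem-arc   = λ a → a
    ; scanned   = λ _ → inj₁
    ; pristine  = λ _ _ → refl
    ; budget    = ≤-refl
    }

  search-run : Run search start (5 + (suc (arcs + arcs) * 13 + 1)) SearchDone
  search-run = lit ⨾ʳ store ⨾ʳ load ⨾ʳ store ⨾ʳ copy ⨾ʳ
    search-loop (suc (arcs + arcs)) ≤-refl search-start record
      { env   = (refl , refl , refl , refl , refl) , refl , refl , refl
      ; stack = cons refl (nil (blank (m≤m+n 3 0) _))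
      ; order = nil refl
      ; rests = rests-push (h aRest) adj {[]} (λ ()) (λ ()) refl (lists s)
      ; marks = marks-push (h aSeen) {[]} (λ u → inj₁ (blank (m≤m+n 3 3) _ , (λ ()) , (λ ()))) refl refl
      }

  -- Propagation of labels

  -- What holds while the arcs leaving u, which has the label ℓ, are traversed; next
  -- holds the links of the topological order.
  RelaxEnv : Fin n → Fin n → (ℕ → ℕ) → State → Set
  RelaxEnv u ℓ next σ = Env σ × reg σ rVertex ≡ code u × reg σ rLabel ≡ code ℓ ×
                        heap σ aOrder ≡ next × heap σ aGroup ≡ h aGroup

  -- The arcs traversed when A has been processed and the arcs from u to ws as well.
  Partial : List (Fin n) → Fin n → List (Fin n) → Fin n → Fin n → Set
  Partial A u ws p v = (p ∈ A × p ⟶ v) ⊎ (p ≡ u × v ∈ ws)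

  Relaxed : List (Fin n) → Fin n → Fin n → (ℕ → ℕ) → List (Fin n) → State → Set
  Relaxed A u ℓ next ws τ = RelaxEnv u ℓ next τ × Σ[ lab ∈ Labels ]
    lab u ≡ just ℓ × Stores (heap τ aRep) lab × Labelled (Partial A u ws) lab

  relax-body : ∀ {A u ℓ next done w ws i σ} → Relaxed A u ℓ next done σ →
    reg σ rArc ≡ suc i → h aEnd (suc i) ≡ code w → LinkedList h (h aNext (suc i)) ws →
    w ≢ s → u ≢ w → w ∉ A →
    Run relaxBody σ 7 (λ τ → LinkedList h (reg τ rArc) ws × Relaxed A u ℓ next (w ∷ done) τ)
  relax-body {A} {u} {ℓ} {next} {done} {w} {ws} {i} {σ} ((env , u≡ , ℓ≡ , rest) , lab , lab-u , stores , L)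
             arc≡ end list w≢s u≢w w∉A = body
    where
    idle : ∀ {x} → ¬ Partial A u done w x
    idle (inj₁ (w∈A , _)) = w∉A w∈A
    idle (inj₂ (w≡u , _)) = u≢w (sym w≡u)

    old : ∀ {p x} → Partial A u done p x → Partial A u (w ∷ done) p x
    old (inj₁ e)         = inj₁ e
    old (inj₂ (e , i))   = inj₂ (e , there i)

    split : ∀ {p x} → Partial A u (w ∷ done) p x → Partial A u done p x ⊎ (p ≡ u × x ≡ w)
    split (inj₁ e)              = inj₁ (inj₁ e)
    split (inj₂ (e , here e′))  = inj₂ (e , e′)
    split (inj₂ (e , there i))  = inj₁ (inj₂ (e , i))

    open Relabel old split (inj₂ (refl , here refl)) u≢w idle

    w≡ : heap σ aEnd (reg σ rArc) ≡ code w
    w≡ = env-end σ env arc≡ end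

    list′ : LinkedList h (heap σ aNext (reg σ rArc)) ws
    list′ = env-next σ env arc≡ list

    σ′ : State
    σ′ = setReg (setReg (setReg σ rTarget (heap σ aEnd (reg σ rArc)))
           rArc (heap σ aNext (reg σ rArc))) rTemp (heap σ aRep (heap σ aEnd (reg σ rArc)))

    temp≡ : heap σ aRep (heap σ aEnd (reg σ rArc)) ≡ code? (lab w)
    temp≡ = trans (cong (heap σ aRep) w≡) (stores w)

    store-label : ∀ {x m} → reg σ′ x ≡ code? m → Origin (Partial A u (w ∷ done)) lab w m →
      Run (aRep [ rTarget ]≔ x) σ′ 1 (λ τ → LinkedList h (reg τ rArc) ws × Relaxed A u ℓ next (w ∷ done) τ)
    store-label {m = m} x≡ o = finish store ≤-refl
      (list′ , (env , u≡ , ℓ≡ , rest) , set lab w m , trans (set-other lab u≢w) lab-u ,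
       Stores-set {f = heap σ aRep} stores w≡ x≡ ,
       relabel w≢s (set-other lab) (subst (Origin _ lab w) (sym (set-same lab w)) o) L)

    body : Run relaxBody σ 7 (λ τ → LinkedList h (reg τ rArc) ws × Relaxed A u ℓ next (w ∷ done) τ)
    body with u ≟ s
    ... | yes refl = load ⨾ʳ load ⨾ʳ load ⨾ʳ Run-weaken (m≤m+n 2 2)
      (Run-then (≡ᵇ-true (trans u≡ (sym (env-root σ env)))) (store-label w≡ (relax-root refl)))
    ... | no u≢s = load ⨾ʳ load ⨾ʳ load ⨾ʳ
      Run-else (≡ᵇ-false (λ e → u≢s (code-injective (trans (sym u≡) (trans e (env-root σ env))))))
        (by-label (lab w) refl)
      where
      by-label : ∀ m → lab w ≡ m → Run _ σ′ 3 _
      by-label nothing e = Run-weaken (m≤m+n 2 1)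
        (Run-then (≡ᵇ-true (trans temp≡ (trans (cong code? e) (sym (env-zero σ env)))))
          (store-label ℓ≡ (relax-first u≢s lab-u (subst (Origin _ lab w) e (Labelled.origin L w≢s)))))
      by-label (just r) e = Run-else
        (≡ᵇ-false (λ e′ → 1+n≢0 (trans (sym (trans temp≡ (cong code? e))) (trans e′ (env-zero σ env)))))
        (compare (r ≟ ℓ))
        where
        o : Origin (Partial A u done) lab w (just r)
        o = subst (Origin _ lab w) e (Labelled.origin L w≢s)
        compare : _ → Run _ σ′ 2 _
        compare (yes refl) = Run-then (≡ᵇ-true (trans temp≡ (trans (cong code? e) (sym ℓ≡))))
          (finish skip ≤-refl (list′ , (env , u≡ , ℓ≡ , rest) , lab , lab-u , stores ,
            relabel w≢s (λ _ → refl) (subst (Origin _ lab w) (sym e) (relax-agree u≢s lab-u o)) L))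
        compare (no r≢ℓ) = Run-else
          (≡ᵇ-false (λ e′ → r≢ℓ (code-injective (trans (sym (trans temp≡ (cong code? e))) (trans e′ ℓ≡)))))
          (store-label w≡ (relax-differ lab-u r≢ℓ o))

  Processed : List (Fin n) → Fin n → Fin n → Set
  Processed A p v = p ∈ A × p ⟶ v

  LabelEnv : (ℕ → ℕ) → State → Set
  LabelEnv next σ = Env σ × heap σ aOrder ≡ next × heap σ aGroup ≡ h aGroup

  -- done and ws together make up the out-neighbours of u.
  relax-loop : ∀ {A u ℓ next done ws σ} → Relaxed A u ℓ next done σ → LinkedList h (reg σ rArc) ws →
    (∀ {w} → w ∈ ws → w ≢ s × u ≢ w × w ∉ A) →
    (∀ {w} → u ⟶ w → w ∈ done ⊎ w ∈ ws) → (∀ {w} → w ∈ done ⊎ w ∈ ws → u ⟶ w) →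
    Run (While rZero << rArc Do relaxBody) σ (length ws * 8 + 1)
      (λ τ → RelaxEnv u ℓ next τ × Σ[ lab ∈ Labels ]
        Stores (heap τ aRep) lab × Labelled (Processed (u ∷ A)) lab)
  relax-loop {A} {u} {ℓ} {done = done} {σ = σ} (env , lab , lab-u , stores , L) list fresh all sound
    = go list refl
    where
    to : ∀ {ws} → ws ≡ [] → (∀ {w} → u ⟶ w → w ∈ done ⊎ w ∈ ws) →
         ∀ {p v} → Processed (u ∷ A) p v → Partial A u done p v
    to refl all (here refl , a) with all a
    ... | inj₁ i = inj₂ (refl , i)
    to _ _ (there i , a) = inj₁ (i , a)
    from : ∀ {p v} → Partial A u done p v → Processed (u ∷ A) p v
    from (inj₁ (i , a))    = there i , a
    from (inj₂ (refl , i)) = here refl , sound (inj₁ i)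

    go : ∀ {p} → LinkedList h p _ → reg σ rArc ≡ p → Run _ σ _ _
    go nil arc≡ = Run-exit {b = 0} (not-positive (env-zero σ (proj₁ env)) arc≡)
      (env , lab , stores , Labelled-resp from (to refl all) L)
    go (cons {v = w} {vs = ws} end list) arc≡ with fresh (here refl)
    ... | w≢s , u≢w , w∉A = Run-while (positive (env-zero σ (proj₁ env)) arc≡)
      (relax-body (env , lab , lab-u , stores , L) arc≡ end list w≢s u≢w w∉A)
      (λ { (list′ , R) → relax-loop R list′ (fresh ∘ there) all′ sound′ })
      where
      all′ : ∀ {x} → u ⟶ x → x ∈ w ∷ done ⊎ x ∈ ws
      all′ a with all a
      ... | inj₁ i         = inj₁ (there i)
      ... | inj₂ (here e)  = inj₁ (here e)
      ... | inj₂ (there i) = inj₂ i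
      sound′ : ∀ {x} → x ∈ w ∷ done ⊎ x ∈ ws → u ⟶ x
      sound′ (inj₁ (here e))  = sound (inj₂ (here e))
      sound′ (inj₁ (there i)) = sound (inj₁ i)
      sound′ (inj₂ i)         = sound (inj₂ (there i))

  LabelDone : (ℕ → ℕ) → State → Set
  LabelDone next τ = LabelEnv next τ × Σ[ rep ∈ Labels ] Stores (heap τ aRep) rep × Labelled Traversed rep

  degrees : List (Fin n) → ℕ
  degrees B = sum (map (length ∘ adj) B)

  -- The time is 5 for each vertex and 8 for each arc.
  label-loop : ∀ {A B next lab σ} → Split A B → LabelEnv next σ → Chain next (reg σ rVertex) B →
    Stores (heap σ aRep) lab → Labelled (Processed A) lab →
    Run (While rZero << rVertex Do labelBody) σ (length B * 5 + degrees B * 8 + 1) (LabelDone next)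
  label-loop {A} {σ = σ} S env (nil v≡) stores L =
    Run-exit {b = 0} (not-positive (env-zero σ (proj₁ env)) v≡)
      (env , _ , stores , Labelled-resp (λ (i , a) → Split.visited S i , a) back L)
    where
    back : ∀ {p v} → Traversed p v → Processed A p v
    back (P , a) with Split.covers S P
    ... | inj₁ i = i , a
  label-loop {A} {u ∷ B} {next} {lab} {σ} S env (cons u≡ chain) stores L with labelled
    where
    -- When u is reached in the order, one of its in-neighbours has been processed, unless u is s.
    labelled : ∃[ ℓ ] lab u ≡ just ℓ
    labelled with u ≟ s
    ... | yes refl = s , Labelled.root L
    ... | no  u≢s with last-arc (Split.reached S (here refl)) u≢s | lab u | Labelled.origin L u≢s
    ...   | p , P , a | .nothing  | untouched no-arc = contradiction (split-pred S P a , a) no-arc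
    ...   | _         | .(just _) | from-root _      = _ , refl
    ...   | _         | .(just _) | merged _ _ _     = _ , refl
    ...   | _         | .(just _) | inherited _ _    = _ , refl
  ... | ℓ , lab-u = Run-weaken (≤-reflexive (cost (length (adj u)) (length B) (degrees B)))
    (Run-while (positive (env-zero σ (proj₁ env)) u≡)
      (load ⨾ʳ load ⨾ʳ Run-seq
        (relax-loop {done = []}
          ((proj₁ env , u≡ , trans (cong (heap σ aRep) u≡) (trans (stores u) (cong code? lab-u)) , proj₂ env) ,
            lab , lab-u , stores ,
            Labelled-resp inj₁ (λ { (inj₁ e) → e ; (inj₂ (_ , ())) }) L)
          (subst (λ i → LinkedList h (heap σ aHead i) (adj u)) (sym u≡) (env-list σ u (proj₁ env)))
          fresh inj₂ (λ { (inj₂ a) → a }))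
        after)
      (λ { (lab′ , env′ , chain′ , stores′ , L′) → label-loop (advance S) env′ chain′ stores′ L′ }))
    where
    cost : ∀ d l ds → suc (2 + (d * 8 + 1 + 1) + (l * 5 + ds * 8 + 1)) ≡ 5 + l * 5 + (d + ds) * 8 + 1
    cost = solve-∀

    fresh : ∀ {w} → w ∈ adj u → w ≢ s × u ≢ w × w ∉ A
    fresh a = (λ { refl → no-cycle a (Split.reached S (here refl)) }) , (λ { refl → no-cycle a ε }) ,
              λ i → Split.fresh (advance S) (there i) (out a)
      where
      out : ∀ {w} → u ⟶ w → w ∈ B
      out a with Split.sorted S
      ... | (_ , f) ∷ _ = f a

    After : State → Set
    After τ = Σ[ lab′ ∈ Labels ] LabelEnv next τ × Chain next (reg τ rVertex) B ×
              Stores (heap τ aRep) lab′ × Labelled (Processed (u ∷ A)) lab′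

    after : ∀ {τ} → RelaxEnv u ℓ next τ × Σ[ lab ∈ Labels ]
              Stores (heap τ aRep) lab × Labelled (Processed (u ∷ A)) lab →
            Run (rVertex ≔ aOrder [ rVertex ]) τ 1 After
    after ((env′ , u≡′ , _ , order≡ , group≡) , lab′ , stores′ , L′) = finish load ≤-refl
      (lab′ , (env′ , order≡ , group≡) ,
       subst (λ q → Chain next q B)
         (trans (cong next (trans u≡ (sym u≡′))) (cong (_$ _) (sym order≡))) chain ,
       stores′ , L′)

  -- Construction of the grouped list

  module Group {rep : Labels} (labelled : Labelled Traversed rep) where
    open Complete labelled

    GroupEnv : (ℕ → ℕ) → State → Set
    GroupEnv next σ = Env σ × heap σ aOrder ≡ next × Stores (heap σ aRep) rep

    GroupDone : State → Set
    GroupDone τ = Stores (heap τ aRep) rep × Σ[ A ∈ List (Fin n) ] Σ[ M ∈ List (Fin n) ]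
      Chain (heap τ aGroup) (code s) M × Grouping rep A M × Split A []

    -- After this step, rLabel holds the vertex after which v is to be inserted.
    choose : ∀ {next A B M v r σ} → GroupEnv next σ → Chain (heap σ aGroup) (code s) M →
      Split A (v ∷ B) → Grouping rep A M → v ≢ s → reg σ rVertex ≡ code v → rep v ≡ just r →
      reg σ rLabel ≡ code r →
      Run (If rLabel == rVertex Then rLabel ≔reg rRoot Else skip) σ 2 (λ τ →
        GroupEnv next τ × Chain (heap τ aGroup) (code s) M × reg τ rVertex ≡ code v ×
        Σ[ q ∈ Fin n ] reg τ rLabel ≡ code q × InsertionPoint rep M v q × (r ≡ v ⊎ r ∈ M))
    choose {v = v} {r} {σ} env chain S Γ v≢s v≡ e r≡ with r ≟ v
    ... | yes refl = Run-then (≡ᵇ-true (trans r≡ (sym v≡))) (finish copy ≤-refl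
      (env , chain , v≡ , s , env-root σ (proj₁ env) ,
       own-block labelled (Grouping.root∈ Γ) v≢s e , inj₁ refl))
    ... | no r≢v = Run-else (≡ᵇ-false λ e′ → r≢v (code-injective (trans (sym r≡) (trans e′ v≡))))
      (finish skip ≤-refl (env , chain , v≡ , r , r≡ , same-block labelled r∈ v≢s e , inj₂ r∈))
      where
      r∈ = rep-before labelled S Γ v≢s e r≢v

    group-loop : ∀ {next A B M σ} → GroupEnv next σ → Chain next (reg σ rVertex) B →
      Chain (heap σ aGroup) (code s) M → Split A B → Grouping rep A M → s ∈ A →
      Run (While rZero << rVertex Do groupBody) σ (length B * 8 + 1) GroupDone
    group-loop {A = A} {B = []} {M} {σ} env (nil v≡) chain S Γ _ =
      Run-exit {b = 0} (not-positive (env-zero σ (proj₁ env)) v≡)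
        (proj₂ (proj₂ env) , A , M , chain , Γ , S)
    group-loop {next} {A} {v ∷ B} {M} {σ} env (cons v≡ rest) chain S Γ s∈A
      with reached⇒labelled (Split.reached S (here refl))
    ... | r , e = Run-while (positive (env-zero σ (proj₁ env)) v≡)
      (load ⨾ʳ Run-seq
        (choose env chain S Γ v≢s v≡ e
          (trans (cong (heap σ aRep) v≡) (trans (proj₂ (proj₂ env) v) (cong code? e))))
        after)
      (λ { (N , env′ , rest′ , chain′ , Γ′) → group-loop env′ rest′ chain′ (advance S) Γ′ (there s∈A) })
      where
      v≢s : v ≢ s
      v≢s refl = Split.fresh S s∈A (here refl)

      After : State → Set
      After τ = Σ[ N ∈ List (Fin n) ] GroupEnv next τ × Chain next (reg τ rVertex) B ×
        Chain (heap τ aGroup) (code s) N × Grouping rep (v ∷ A) N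

      after : ∀ {τ} → _ → Run _ τ 4 After
      after {τ} (env′ , chain′ , v≡′ , q , q≡ , point , r∈) with insert (proj₁ point)
      ... | N , I = finish (load ⨾ store ⨾ store ⨾ load) ≤-refl
        (N , env′ ,
         subst (λ p → Chain next p B)
           (trans (cong next (trans v≡ (sym v≡′))) (cong (_$ _) (sym (proj₁ (proj₂ env′))))) rest ,
         Chain-insert v≡′ q≡ (λ i → Split.fresh S (Grouping.sound Γ i) (here refl))
           (Grouping.unique Γ) I chain′ ,
         grouping-insert labelled S Γ point I e r∈)

  -- What the construction leaves in the heap H.  The topological order s ∷ L is not
  -- used by the programs, but it gives the disjoint paths.
  Built : Heap → Set
  Built H = Σ[ rep ∈ Labels ] Labelled Traversed rep × Stores (H aRep) rep ×
    Σ[ L ∈ List (Fin n) ] Split (s ∷ []) L × Σ[ A ∈ List (Fin n) ] Σ[ M ∈ List (Fin n) ]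
      Chain (H aGroup) (code s) M × Grouping rep A M × Split A []

  label-start : Labelled (Processed []) (set (λ _ → nothing) s (just s))
  label-start = record
    { root   = set-same (λ _ → nothing) s
    ; origin = λ v≢s → subst (Origin _ _ _) (sym (set-other (λ _ → nothing) v≢s)) (untouched λ { (() , _) }) }

  -- The search takes at most 26 m + 19 steps, the other two passes together at most
  -- 21 m + 10, where m is the number of arcs.
  build-run : Run buildProgram start (52 * suc arcs) (Built ∘ heap)
  build-run = Run-weaken (cost arcs) (Run-seq search-run after-search)
    where
    cost : ∀ m → 5 + (suc (m + m) * 13 + 1) + 26 * suc m ≤ 52 * suc m
    cost m = ≤-trans (m≤m+n _ 7) (≤-reflexive (equation m))
      where
      equation : ∀ m → 5 + (suc (m + m) * 13 + 1) + 26 * suc m + 7 ≡ 52 * suc m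
      equation = solve-∀

    cost′ : ∀ {m k d} → suc k ≤ suc m → d ≤ m →
            1 + (1 + (suc k * 5 + d * 8 + 1)) + (1 + (k * 8 + 1)) ≤ 26 * suc m
    cost′ {m} {k} {d} (s≤s k≤m) d≤m = ≤-trans
      (+-mono-≤ (+-monoʳ-≤ 2 (+-monoˡ-≤ 1 (+-mono-≤ (*-monoˡ-≤ 5 (s≤s k≤m)) (*-monoˡ-≤ 8 d≤m))))
                (+-monoʳ-≤ 1 (+-monoˡ-≤ 1 (*-monoˡ-≤ 8 k≤m))))
      (≤-trans (m≤m+n _ (16 + m * 5)) (≤-reflexive (equation m)))
      where
      equation : ∀ m → 1 + (1 + (suc m * 5 + m * 8 + 1)) + (1 + (m * 8 + 1)) + (16 + m * 5) ≡ 26 * suc m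
      equation = solve-∀

    after-search : ∀ {τ} → SearchDone τ → Run (label ⨾ group) τ (26 * suc arcs) (Built ∘ heap)
    after-search {τ} ((env , _ , rep≡ , group≡) , fin , rem , chain , S) with root-first (search-split S)
    ... | L , refl with chain
    ...   | cons order≡ rest = Run-weaken
      (cost′ (m+n≤o⇒m≤o (length (s ∷ L)) (Search.budget S))
        (sum≤total (length ∘ adj) (sorted-unique (Search.fin-sort S)))) (Run-seq
      (store ⨾ʳ copy ⨾ʳ label-loop {next = heap τ aOrder} split (env , refl , group≡)
        (cons (env-root τ env)
          (subst (λ p → Chain (heap τ aOrder) (heap τ aOrder p) L)
            (trans order≡ (sym (env-root τ env))) rest))
        (Stores-set {f = heap τ aRep} (λ v → trans (cong (_$ _) rep≡) (blank (m≤m+n 3 4) _))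
          (env-root τ env) (env-root τ env))
        label-start)
      (λ {υ} → after-label {υ}))
      where
      split : Split [] (s ∷ L)
      split = search-split S

      after-label : ∀ {υ} → LabelDone (heap τ aOrder) υ → Run group υ (1 + (length L * 8 + 1)) (Built ∘ heap)
      after-label {υ} ((env′ , order≡′ , group≡′) , rep , stores , labelled) =
        Run-map (λ { (stores′ , A , M , chain′ , Γ , S′) →
            rep , labelled , stores′ , L , advance split , A , M , chain′ , Γ , S′ })
          (load ⨾ʳ group-loop (env′ , order≡′ , stores)
            (subst (λ p → Chain (heap τ aOrder) p L)
              (trans (cong (heap τ aOrder) (trans order≡ (sym (env-root υ env′)))) (cong (_$ _) (sym order≡′))) rest)
            (cons refl (nil (trans (cong (_$ _) group≡′) (blank (m≤m+n 3 5) _))))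
            (advance split) (grouping-start labelled) (here refl))
        where open Group labelled

-- Printing and answering queries

module Print {n : ℕ} (G : DAG n) (s : Fin n) where
  open DAG G
  open Graph G s

  module _ {rep : Labels} (labelled : Labelled Traversed rep) where
    open Complete labelled
    open Listing labelled

    PrintEnv : (ℕ → ℕ) → (V P : List (Fin n)) → State → Set
    PrintEnv next V P σ = reg σ pZero ≡ 0 × Stores (heap σ aRep) rep × heap σ aGroup ≡ next ×
      Chain (heap σ aPrinted) (reg σ pVisited) V × Chain (heap σ aPrinted) (reg σ pOthers) P

    print-row : ∀ {next V P} {y : Fin n} {js ps σ} → PrintEnv next V P σ → reg σ pVertex ≡ code y →
      Chain (heap σ aPrinted) (reg σ pPartner) js → output σ ≡ map codes ps →
      Run printRow σ (length js * 3 + 1) (λ τ →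
        PrintEnv next V P τ × reg τ pVertex ≡ code y × output τ ≡ map codes (row y js ps))
    print-row env y≡ (nil j≡) out = Run-exit {b = 0} (not-positive (proj₁ env) j≡) (env , y≡ , out)
    print-row {next} {V} {P} {y} {j ∷ js} {ps} env y≡ (cons j≡ chain) out = Run-while (positive (proj₁ env) j≡)
      (finish {Q = Next} (emit ⨾ load) ≤-refl (env , y≡ , chain , cong₂ _∷_ (cong₂ _,_ y≡ j≡) out))
      (λ { (env′ , y≡′ , chain′ , out′) → print-row env′ y≡′ chain′ out′ })
      where
      Next : State → Set
      Next τ = PrintEnv next V P τ × reg τ pVertex ≡ code y ×
        Chain (heap τ aPrinted) (reg τ pPartner) js × output τ ≡ map codes ((y , j) ∷ ps)

    print-choose : ∀ {next V P x y ps M σ} → PrintEnv next V P σ → Printed V P x ps → Walk V x (y ∷ M) →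
      reg σ pVertex ≡ code y →
      Run (pTemp ≔ aRep [ pVertex ] ⨾ If pTemp == pVertex Then pOthers ≔reg pVisited Else skip) σ 3
        (λ τ → Σ[ P′ ∈ List (Fin n) ] PrintEnv next V P′ τ × Row V P′ y ×
               reg τ pVertex ≡ code y × output τ ≡ output σ)
    print-choose {y = y} {σ = σ} (zero≡ , stores , group≡ , chainV , chainP) Π W y≡
      with reached⇒labelled (Walk.reached W (here refl)) | Walk.linked W
    ... | r , e | follows ∷ _ with r ≟ y
    ...   | yes refl = load ⨾ʳ Run-then (≡ᵇ-true (trans temp≡ (sym y≡))) (finish copy ≤-refl
      (_ , (zero≡ , stores , group≡ , chainV , chainV) ,
       row-fresh Π (λ i → Walk.fresh W i (here refl)) e , y≡ , refl))
      where
      temp≡ : heap σ aRep (reg σ pVertex) ≡ code y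
      temp≡ = trans (cong (heap σ aRep) y≡) (trans (stores y) (cong code? e))
    ...   | no r≢y = load ⨾ʳ Run-else (≡ᵇ-false (λ e′ → r≢y (code-injective (trans (sym temp≡) (trans e′ y≡)))))
      (finish skip ≤-refl
        (_ , (zero≡ , stores , group≡ , chainV , chainP) , continue follows , y≡ , refl))
      where
      temp≡ : heap σ aRep (reg σ pVertex) ≡ code r
      temp≡ = trans (cong (heap σ aRep) y≡) (trans (stores y) (cong code? e))
      continue : Follows rep _ y → Row _ _ y
      continue (inj₁ e′)         = contradiction (just-injective (trans (sym e) e′)) r≢y
      continue (inj₂ (x≢s , e′)) = row-continue Π x≢s e′

    print-body : ∀ {next V P x y ps M σ} → PrintEnv next V P σ → Printed V P x ps → Walk V x (y ∷ M) →
      reg σ pVertex ≡ code y → output σ ≡ map codes ps →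
      Σ[ P′ ∈ List (Fin n) ] Row V P′ y ×
      Run printBody σ (8 + length P′ * 3) (λ τ →
        PrintEnv next (y ∷ V) P′ τ × reg τ pVertex ≡ next (code y) × output τ ≡ map codes (row y P′ ps))
    print-body {next} {V} {y = y} {ps} {M} {σ} env Π W y≡ out with print-choose {σ = σ} env Π W y≡
    ... | t , τ , run , t≤3 , P′ , (zero≡ , stores , group≡ , chainV , chainP) , ρ , τy≡ , out′ =
      P′ , ρ , Run-weaken (≤-reflexive (cost (length P′))) (Run-seq {Q = _≡ τ} (t , τ , run , t≤3 , refl) λ { refl →
        Run-seq (finish {Q = _≡ τ′} (store ⨾ copy ⨾ copy) ≤-refl refl) λ { refl →
        Run-seq (print-row {js = P′} {ps}
          (zero≡ , stores , group≡ , Chain-push τy≡ y∉V chainV , chainP′) τy≡ chainP′ (trans out′ out))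
        λ { {υ} (env′@(_ , _ , group≡′ , _) , υy≡ , out″) →
        finish load ≤-refl (env′ , trans (cong (heap υ aGroup) υy≡) (cong (_$ _) group≡′) , out″) } } })
      where
      cost : ∀ k → 3 + (3 + (k * 3 + 1 + 1)) ≡ 8 + k * 3
      cost = solve-∀
      y∉V : y ∉ V
      y∉V i = Walk.fresh W i (here refl)
      chainP′ : Chain (heap τ aPrinted [ reg τ pVertex ↦ reg τ pVisited ]) (reg τ pOthers) P′
      chainP′ = Chain-set τy≡ (y∉V ∘ Row.P⊆V ρ) chainP
      τ′ : State
      τ′ = setReg (setReg (setCell τ aPrinted (reg τ pVertex) (reg τ pVisited))
             pVisited (reg τ pVertex)) pPartner (reg τ pOthers)

    -- The bound b on the remaining time is given as b + 12 k ≤ 1 + 12 k′, where k and k′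
    -- are the numbers of pairs printed before and in the end.
    print-loop : ∀ {L next V P x M ps σ} → Split (s ∷ []) L → PrintEnv next V P σ →
      Chain next (reg σ pVertex) M → Printed V P x ps → Walk V x M → output σ ≡ map codes ps →
      Σ[ ps′ ∈ List (Fin n × Fin n) ] ListsJunctionPairs s ps′ ×
      Σ[ b ∈ ℕ ] b + length ps * 12 ≤ 1 + length ps′ * 12 ×
      Run (While pZero << pVertex Do printBody) σ b (λ τ → output τ ≡ map codes ps′)
    print-loop {ps = ps} S env (nil v≡) Π W out =
      ps , lists-pairs S Π W , 1 , ≤-refl , Run-exit {b = 0} (not-positive (proj₁ env) v≡) out
    print-loop {next = next} {V} {M = y ∷ M} {ps} {σ} S env (cons y≡ rest) Π W out
      with print-body {σ = σ} env Π W y≡ out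
    ... | P′ , ρ , (t , τ , run , t≤ , env′ , τy≡ , out′)
      with print-loop {σ = τ} S env′ (subst (λ p → Chain next p M) (trans (cong next y≡) (sym τy≡)) rest)
             (print-row-pairs Π ρ (λ i → Walk.fresh W i (here refl)) (Walk.reached W (here refl)))
             (walk-step W) out′
    ... | ps′ , lists , b , b≤ , (t″ , ω , run″ , t″≤ , out‴) =
      ps′ , lists , suc (8 + length P′ * 3 + b) , bound ,
      (_ , _ , while-true (positive (proj₁ env) y≡) run run″ , s≤s (+-mono-≤ t≤ t″≤) , out‴)
      where
      shift : ∀ k b l → suc (8 + suc k * 3 + b) + l * 12 + k * 9 ≡ b + (suc k + l) * 12
      shift = solve-∀

      -- The row is not empty, as s is in P; hence 9 + 3 l ≤ 12 l for its length l.
      grow : ∀ {P : List (Fin n)} → s ∈ P →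
             suc (8 + length P * 3 + b) + length ps * 12 ≤ b + (length P + length ps) * 12
      grow {_ ∷ P} _ = ≤-trans (m≤m+n _ _) (≤-reflexive (shift (length P) b (length ps)))

      bound : suc (8 + length P′ * 3 + b) + length ps * 12 ≤ 1 + length ps′ * 12
      bound = ≤-trans (grow (Row.root∈P ρ))
        (subst (λ l → b + l * 12 ≤ 1 + length ps′ * 12) (length-row P′) b≤)

    print-run : ∀ {L A M H} → Stores (H aRep) rep → Chain (H aGroup) (code s) M → Grouping rep A M →
      Split (s ∷ []) L → Split A [] →
      Σ[ ps ∈ List (Fin n × Fin n) ] ListsJunctionPairs s ps ×
        Call (52 * suc (length ps)) printProgram (code s ∷ []) H (λ τ → output τ ≡ map codes ps)
    print-run {M = x ∷ M} {H} stores (cons s≡ chain) Γ S T with code-injective s≡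
    ... | refl with print-loop {σ = σ} S
            (refl , stores , refl , cons refl (nil (read-same (H aPrinted) {code s} refl)) , nil refl)
            chain print-start walk refl
      where
      σ : State
      σ = setReg (setReg (setCell (mkState (arguments (code s ∷ [])) H [])
            aPrinted (code s) 0) pVisited (code s)) pVertex (H aGroup (code s))
      open Grouping Γ
      walk : Walk (s ∷ []) s M
      walk with unique
      ... | s∉ ∷ u = record
        { linked = linked ; unique = u ; fresh = λ { (here refl) → All¬⇒¬Any s∉ }
        ; reached = Split.visited T ∘ sound ∘ there ; covers = covers }
        where
        covers : ∀ {y} → Path s y → y ∈ s ∷ [] ⊎ y ∈ M
        covers P with Split.covers T P
        ... | inj₁ i with all i
        ...   | here e  = inj₁ (here e)
        ...   | there j = inj₂ j
    ... | ps , lists , b , b≤ , run = ps , lists , Run-weaken bound (store ⨾ʳ copy ⨾ʳ load ⨾ʳ run)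
      where
      cost : ∀ l → 3 + (1 + l * 12) + (48 + l * 40) ≡ 52 * suc l
      cost = solve-∀
      bound : 3 + b ≤ 52 * suc (length ps)
      bound = ≤-trans (+-monoʳ-≤ 3 (≤-trans (≤-reflexive (sym (+-identityʳ b))) b≤))
        (≤-trans (m≤m+n _ (48 + length ps * 40)) (≤-reflexive (cost (length ps))))

    decide-run : ∀ {L} → Split (s ∷ []) L → ∀ u v h →
      Call 52 decideProgram (code s ∷ code u ∷ code v ∷ code? (rep u) ∷ code? (rep v) ∷ []) h (λ τ →
        heap τ ≡ h × Decides (Junction s u v) (result τ))
    decide-run S u v h with rep u in u≡ | rep v in v≡
    ... | nothing | _ = finish (if-true refl lit) (m≤m+n _ _) (refl , inj₂ (unlabelled , refl))
      where
      unlabelled : ¬ Junction s u v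
      unlabelled (_ , P , _) with reached⇒labelled P
      ... | _ , e = nothing≢just (trans (sym u≡) e)
    ... | just a | nothing = finish (if-false refl (if-true refl lit)) (m≤m+n _ _)
      (refl , inj₂ (unlabelled , refl))
      where
      unlabelled : ¬ Junction s u v
      unlabelled (_ , _ , Q , _) with reached⇒labelled Q
      ... | _ , e = nothing≢just (trans (sym v≡) e)
    ... | just a | just b with a ≟ b
    ...   | yes refl = finish (if-false refl (if-false refl (if-true (≡ᵇ-true {code a} refl) lit))) (m≤m+n _ _)
      (refl , inj₂ ((λ J → proj₂ (proj₂ (junction⇒separated J)) (trans u≡ (sym v≡))) , refl))
    ...   | no a≢b = finish (if-false refl (if-false refl (if-false (≡ᵇ-false {code a} (a≢b ∘ code-injective)) lit)))
      (m≤m+n _ _)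
      (refl , inj₁ (separated⇒junction labelled S
        (labelled⇒reached u≡ , labelled⇒reached v≡ ,
         λ e → a≢b (just-injective (trans (sym u≡) (trans e v≡)))) , refl))

theorem1 : Σ[ build ∈ Program ] Σ[ find ∈ Program ] Σ[ decide ∈ Program ] Σ[ print ∈ Program ]
    Σ[ c ∈ ℕ ]
    (∀ (n : ℕ) (G : DAG n) (s : Fin n) (h : Heap) → AdjacencyLists h G →
    let open DAG G in
    Call (c * suc arcs) build (n ∷ arcs ∷ code s ∷ []) h (λ built →
    Σ[ D ∈ DisjointSets n ]
    let open DisjointSets D in
    (∀ v → Call c find (code v ∷ []) (heap built) (λ τ →
    heap τ ≡ heap built × result τ ≡ code? (rep v)))
    × (∀ u v h′ →
    Call c decide (code s ∷ code u ∷ code v ∷ code? (rep u) ∷ code? (rep v) ∷ []) h′ (λ τ →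
    heap τ ≡ h′ × Decides (Junction s u v) (result τ)))
    × (Σ[ ps ∈ List (Fin n × Fin n) ]
    ListsJunctionPairs s ps
    × Call (c * suc (length ps)) print (code s ∷ []) (heap built) (λ τ →
    output τ ≡ map codes ps))))
theorem1 = buildProgram , findProgram , decideProgram , printProgram , 52 , λ n G s h input →
  Run-map (λ { (rep , labelled , stores , L , S , A , M , chain , Γ , T) →
      record { rep = rep ; rep-idem = Graph.Complete.rep-idem G s labelled } ,
      (λ v → finish load (m≤m+n 1 51) (refl , stores v)) ,
      Print.decide-run G s labelled S ,
      Print.print-run G s labelled stores chain Γ S T })
    (Build.build-run G s h input)
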